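{- Let $H=(h_1>h_2>\cdots>h_p=1)$ be a decreasing gap sequence. Suppose, for some $1\le s<p$, that $S_s=\langle a,b\rangle$, where $a,b\ge2$ are coprime integers, and that $n\ge(a-1)(b-1)$. Then there is a permutation of length $n$ that is $d$-sorted for every $d\in S_s$ and has at least $U_s(n)/24$ inversions. Consequently, $$W_n(H)\ \ge\ \frac{U_s(n)}{24(2h_{s+1}-1)}.$$ If $s=p-1$, this simplifies to $W_n(H)\ge U_{p-1}(n)/24$. The same lower bounds hold for $C_n(H)$.
   Context: Shellsort: a gap sequence is a decreasing sequence of positive integers $H=(h_1>h_2>\cdots>h_p=1)$. On an array of $n$ distinct keys (a permutation), pass $j$ runs ordinary insertion sort separately on each $h_j$-chain, i.e. on each set of positions with the same remainder modulo $h_j$: the key is repeatedly compared with the key $h_j$ positions before it, exchanging the two if they are out of order, until no exchange is needed or the start of the chain is reached. Passes are run for $j=1,2,\dots,p$. $W_n(H)$ and $C_n(H)$ are the worst-case (over all inputs of $n$ keys) total numbers of exchanges and of comparisons. An array $x$ is $d$-sorted if $x_i\le x_{i+d}$ whenever both positions exist. For $0\le s\le p$, $S_s=\{\sum_{i=1}^s x_ih_i: x_i\in\mathbb N_0\}$, and $\langle a,b\rangle=\{xa+yb:x,y\in\mathbb N_0\}$. $U_s(n)=\sum_{1\le d<n,\ d\notin S_s}(n-d)$. -}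

module Defs where

open import Data.Bool.Base using (if_then_else_)
open import Data.Fin.Base as Fin using (Fin; toℕ; fromℕ<)
import Data.Fin.Properties as Fin
open import Data.Fin.Permutation as Perm
  using (Permutation′; _⟨$⟩ʳ_; _≈_; insert; remove; insert-remove)
open import Data.List.Base as List
  using (List; []; _∷_; allFin; cartesianProduct; cartesianProductWith; filter; foldl; length; map; take; upTo; zipWith)
open import Data.List.Extrema.Nat using (max)
open import Data.List.Membership.Propositional.Properties using (∈-allFin; ∈-lookup)
open import Data.List.Relation.Unary.All as All using (All)
open import Data.List.Relation.Unary.Any as Any using (Any; here)
import Data.List.Relation.Unary.Any.Properties as Any
open import Data.List.Relation.Unary.Linked using (Linked)
open import Data.Maybe.Base using (just)
open import Data.Nat.Base
open import Data.Nat.ListAction using (sum)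
open import Data.Nat.Properties
open import Data.Product using (∃; ∃₂; _×_; _,_)
open import Data.Vec.Base as Vec using (Vec; lookup; tabulate; toList; _[_]≔_)
open import Function.Base using (_∘_)
open import Level using (0ℓ)
open import Relation.Binary.PropositionalEquality
open import Relation.Nullary using (does; yes; no; ¬?; _×-dec_)
open import Relation.Nullary.Decidable using (map′)
open import Relation.Unary using (Pred; Decidable)

record GapSequence : Set where
  field
    gaps       : List ℕ
    positive   : All NonZero gaps
    decreasing : Linked _>_ gaps
    last-gap   : List.last gaps ≡ just 1

  p : ℕ
  p = length gaps

  -- The list is indexed from 0, so for s < p this is h_{s+1}.
  gapAfter : (s : ℕ) → s < p → ℕ
  gapAfter s s<p = List.lookup gaps (fromℕ< s<p)

  denominator-nonZero : ∀ s (s<p : s < p) → NonZero (24 * (2 * gapAfter s s<p ∸ 1))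
  denominator-nonZero s s<p = m*n≢0 24 (2 * h ∸ 1) {{_}} {{2h∸1≢0}}
    where
    h = gapAfter s s<p
    1≤h : 1 ≤ h
    1≤h = >-nonZero⁻¹ h {{All.lookup positive (∈-lookup (fromℕ< s<p))}}
    2h∸1≢0 : NonZero (2 * h ∸ 1)
    2h∸1≢0 = >-nonZero (m<n⇒0<n∸m (*-monoʳ-≤ 2 1≤h))

open GapSequence public using (gaps; p; gapAfter; denominator-nonZero)

Combination : List ℕ → Pred ℕ 0ℓ
Combination hs d = ∃ λ (xs : Vec ℕ (length hs)) → sum (zipWith _*_ (toList xs) hs) ≡ d

S : GapSequence → ℕ → Pred ℕ 0ℓ
S H s = Combination (take s (gaps H))

⟨_,_⟩ : ℕ → ℕ → Pred ℕ 0ℓ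
⟨ a , b ⟩ d = ∃₂ λ x y → x * a + y * b ≡ d

-- Searching coefficients x ≤ d suffices: if h is 0 then x may be taken to be 0.
combination? : ∀ hs → Decidable (Combination hs)
combination? []       d = map′ (λ 0≡d → Vec.[] , 0≡d) (λ { (Vec.[] , 0≡d) → 0≡d }) (0 ≟ d)
combination? (h ∷ hs) d = map′ to from (anyUpTo? (λ x → (x * h ≤? d) ×-dec combination? hs (d ∸ x * h)) (suc d))
  where
  to : _ → Combination (h ∷ hs) d
  to (x , _ , xh≤d , xs , eq) = x Vec.∷ xs , trans (cong (x * h +_) eq) (m+[n∸m]≡n xh≤d)

  bounded : ∀ h′ x e → x * h′ + e ≡ d → ∃ λ y → y < suc d × y * h′ ≡ x * h′
  bounded zero      x e eq = 0 , s≤s z≤n , sym (*-zeroʳ x)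
  bounded h′@(suc _) x e eq =
    x , s≤s (≤-trans (m≤m*n x h′) (≤-trans (m≤m+n (x * h′) e) (≤-reflexive eq))) , refl

  from : Combination (h ∷ hs) d → _
  from (x Vec.∷ xs , eq) with bounded h x _ eq
  ... | y , y≤d , yh≡xh =
    y , y≤d
      , subst (_≤ d) (sym yh≡xh) (≤-trans (m≤m+n (x * h) _) (≤-reflexive eq))
      , xs , sym (trans (cong₂ _∸_ (sym eq) yh≡xh) (m+n∸m≡n (x * h) _))

S? : ∀ H s → Decidable (S H s)
S? H s = combination? (take s (gaps H))

U : GapSequence → ℕ → ℕ → ℕ
U H s n = sum (map (n ∸_) (filter (λ d → (1 ≤? d) ×-dec ¬? (S? H s d)) (upTo n)))

Array : ℕ → Set
Array n = Vec (Fin n) n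

array : ∀ {n} → Permutation′ n → Array n
array π = tabulate (π ⟨$⟩ʳ_)

Sorted : ∀ {n} → ℕ → Array n → Set
Sorted d x = ∀ i j → toℕ j ≡ toℕ i + d → lookup x i Fin.≤ lookup x j

Inversion : ∀ {n} → Array n → Pred (Fin n × Fin n) 0ℓ
Inversion x (i , j) = i Fin.< j × lookup x j Fin.< lookup x i

inversion? : ∀ {n} (x : Array n) → Decidable (Inversion x)
inversion? x (i , j) = (i Fin.<? j) ×-dec (lookup x j Fin.<? lookup x i)

inversions : ∀ {n} → Array n → ℕ
inversions {n} x = length (filter (inversion? x) (cartesianProduct (allFin n) (allFin n)))

exchange : ∀ {n} → Fin n → Fin n → Array n → Array n
exchange i j x = (x [ i ]≔ lookup x j) [ j ]≔ lookup x i

record State (n : ℕ) : Set where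
  constructor state
  field
    keys        : Array n
    exchanges   : ℕ
    comparisons : ℕ

open State public

h-before : ∀ {n} h r k → r + suc k * h < n → r + k * h < n
h-before h r k = ≤-<-trans (+-monoʳ-≤ r (m≤n+m (k * h) h))

-- Positions are numbered from 0; the h-chain with remainder r < h consists of
-- the positions r + k * h < n.  The key at r + k * h is moved towards the
-- start r of its chain.
insertKey : ∀ {n} (h r k : ℕ) → .(r + k * h < n) → State n → State n
insertKey h r zero    _   σ = σ
insertKey h r (suc k) i<n (state x e c) =
  let i = fromℕ< i<n
      j = fromℕ< (h-before h r k i<n)
  in if does (lookup x i Fin.<? lookup x j)
     then insertKey h r k (h-before h r k i<n) (state (exchange i j x) (suc e) (suc c))
     else state x e (suc c)

insertKeyIfInRange : ∀ {n} (h r k : ℕ) → State n → State n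
insertKeyIfInRange {n} h r k σ with r + k * h <? n
... | yes i<n = insertKey h r k i<n σ
... | no  _   = σ

-- For h ≥ 1 every position r + k * h < n has k < n.
sortChain : ∀ {n} (h r : ℕ) → State n → State n
sortChain {n} h r σ = foldl (λ τ k → insertKeyIfInRange h r k τ) σ (upTo n)

pass : ∀ {n} → ℕ → State n → State n
pass h σ = foldl (λ τ r → sortChain h r τ) σ (upTo h)

shellsort : ∀ {n} → GapSequence → Array n → State n
shellsort H x = foldl (λ τ h → pass h τ) (state x 0 0) (gaps H)

permutations : ∀ n → List (Permutation′ n)
permutations zero    = Perm.id ∷ []
permutations (suc n) = cartesianProductWith (insert Fin.zero) (allFin (suc n)) (permutations n)

permutations-complete : ∀ {n} (π : Permutation′ n) → Any (π ≈_) (permutations n)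
permutations-complete {zero}  π = here λ ()
permutations-complete {suc n} π =
  Any.cartesianProductWith⁺ (insert Fin.zero) combine
    (∈-allFin (π ⟨$⟩ʳ Fin.zero)) (permutations-complete (remove Fin.zero π))
  where
  combine : ∀ {j ρ} → π ⟨$⟩ʳ Fin.zero ≡ j → remove Fin.zero π ≈ ρ → π ≈ insert Fin.zero j ρ
  combine {ρ = ρ} refl π′≈ρ Fin.zero    = refl
  combine {ρ = ρ} refl π′≈ρ (Fin.suc i) =
    trans (sym (insert-remove Fin.zero π (Fin.suc i)))
          (cong (Fin.punchIn (π ⟨$⟩ʳ Fin.zero)) (π′≈ρ i))

worstCase : (n : ℕ) → (Array n → ℕ) → ℕ
worstCase n cost = max 0 (map (cost ∘ array) (permutations n))

W : ℕ → GapSequence → ℕ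
W n H = worstCase n (exchanges ∘ shellsort H)

C : ℕ → GapSequence → ℕ
C n H = worstCase n (comparisons ∘ shellsort H)

-- Write m + ab = Xa + Yb with 0 ≤ Y < a.  Ordering positions lexicographically by (X , Y) respects every
-- difference in ⟨a , b⟩, and so does every translate of this order.  A gap d has X < b, and among the translates
-- by tb, t < a, exactly a − Y reverse the pair (i , i + d).  With a and b exchanged, b − X of b translates do.
-- As (a − Y)/a + (b − X)/b = 1 − d/(ab), averaging gives a translate with at least ½ Σ (n − d)(1 − d/(ab))
-- inversions, the sum being over the gaps.  Subtracting a⌊b/2⌋ sends the gaps above a⌊b/2⌋ injectively to gaps
-- below it, whose weights n − d are larger; so half of U comes from gaps d ≤ ab/2, and the translate has at
-- least U/8 inversions.
--
-- On this permutation the first s passes exchange nothing.  Every later exchange is at a distance h ≤ h_{s+1} and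
-- removes at most 2h − 1 inversions, and the last pass leaves none.
module Submission where

open import Defs
open import Data.Bool.Base using (if_then_else_; true; false)
open import Data.Empty using (⊥-elim)
open import Data.Fin.Base as Fin using (Fin; toℕ; fromℕ<; zero; suc; punchOut)
open import Data.Fin.Permutation as Perm using (Permutation′; _⟨$⟩ʳ_)
import Data.Fin.Properties as Fin
open import Data.List.Base as List
  using (List; []; _∷_; _++_; applyUpTo; cartesianProduct; drop; filter; foldl; length; map; take; upTo)
open import Data.List.Extrema.Nat using (v≤max⁺)
import Data.List.Properties as List
open import Data.List.Relation.Unary.All as All using (All; []; _∷_)
open import Data.List.Relation.Unary.AllPairs using (AllPairs; []; _∷_)
open import Data.List.Relation.Unary.Any as Any using (Any)
import Data.List.Relation.Unary.Any.Properties as Any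
open import Data.List.Relation.Unary.Linked.Properties using (Linked⇒AllPairs)
open import Data.Maybe.Base using (just)
open import Data.Nat.Base hiding (_/_)
open import Data.Nat.Coprimality as Coprime using (Coprime; coprime-Bézout; coprime-divisor)
open import Data.Nat.Divisibility using (_∣_; divides; ∣⇒≤)
open import Data.Nat.DivMod as ℕ
  using (m≡m%n+[m/n]*n; m%n<n; m<n⇒m%n≡m; m<n⇒m/n≡0; m≥n⇒m/n>0; [m+n]%n≡m%n; [m+kn]%n≡m%n)
open import Data.Nat.GCD using (module Bézout)
import Data.Nat.ListAction as ℕ
open import Data.Nat.Properties
open import Data.Nat.Tactic.RingSolver using (solve-∀)
open import Data.Product using (Σ-syntax; ∃; ∃₂; _×_; _,_; proj₁; proj₂)
open import Data.Sum using (_⊎_; inj₁; inj₂)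
open import Data.Vec.Base as Vec using (lookup; toList)
import Data.Vec.Properties as Vec
open import Algebra.Properties.Semiring.Sum +-*-semiring
  using (sum; sum-syntax; sum-cong-≗; sum-replicate-zero; sum-permute; ∑-comm; ∑-distrib-+; *-distribˡ-sum; *-distribʳ-sum)
open import Function.Base using (_∘_; id)
open import Level using (0ℓ)
open import Relation.Binary.Definitions using (tri<; tri≈; tri>)
open import Relation.Binary.PropositionalEquality
open import Relation.Nullary using (Dec; yes; no; does; ¬_; ¬?; contradiction; _×-dec_)
open import Relation.Unary using (Pred; Decidable; _≐_)

-- Indicators and finite sums.

𝟙 : ∀ {P : Set} → Dec P → ℕ
𝟙 P? = if does P? then 1 else 0

𝟙-mono : ∀ {P Q : Set} (P? : Dec P) (Q? : Dec Q) → (P → Q) → 𝟙 P? ≤ 𝟙 Q?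
𝟙-mono (no _)  _       _   = z≤n
𝟙-mono (yes _) (yes _) _   = ≤-refl
𝟙-mono (yes p) (no ¬q) P⇒Q = contradiction (P⇒Q p) ¬q

𝟙-yes : ∀ {P : Set} (P? : Dec P) → P → 𝟙 P? ≡ 1
𝟙-yes (yes _) _ = refl
𝟙-yes (no ¬p) p = contradiction p ¬p

𝟙-no : ∀ {P : Set} (P? : Dec P) → ¬ P → 𝟙 P? ≡ 0
𝟙-no (no _)  _  = refl
𝟙-no (yes p) ¬p = contradiction p ¬p

𝟙-≤ : ∀ {P : Set} (P? : Dec P) {m} → (P → 1 ≤ m) → 𝟙 P? ≤ m
𝟙-≤ (yes p) 1≤m = 1≤m p
𝟙-≤ (no _)  _   = z≤n

𝟙≤1 : ∀ {P : Set} (P? : Dec P) → 𝟙 P? ≤ 1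
𝟙≤1 (yes _) = ≤-refl
𝟙≤1 (no _)  = z≤n

𝟙*-mono : ∀ {P : Set} (P? : Dec P) {m n} → (P → m ≤ n) → 𝟙 P? * m ≤ 𝟙 P? * n
𝟙*-mono (no _)  _   = z≤n
𝟙*-mono (yes p) m≤n = *-monoʳ-≤ 1 (m≤n p)

sum-mono-≤ : ∀ {n} {f g : Fin n → ℕ} → (∀ i → f i ≤ g i) → sum f ≤ sum g
sum-mono-≤ {zero}  f≤g = z≤n
sum-mono-≤ {suc n} f≤g = +-mono-≤ (f≤g zero) (sum-mono-≤ (f≤g ∘ suc))

sum-mono-< : ∀ {n} {f g : Fin n → ℕ} → (∀ i → f i ≤ g i) → ∀ i → f i < g i → sum f < sum g
sum-mono-< f≤g zero    fi<gi = +-mono-<-≤ fi<gi (sum-mono-≤ (f≤g ∘ suc))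
sum-mono-< f≤g (suc i) fi<gi = +-mono-≤-< (f≤g zero) (sum-mono-< (f≤g ∘ suc) i fi<gi)

sum-0 : ∀ {n} {f : Fin n → ℕ} → (∀ i → f i ≡ 0) → sum f ≡ 0
sum-0 {n} f≗0 = trans (sum-cong-≗ f≗0) (sum-replicate-zero n)

sum-1 : ∀ n → ∑[ i < n ] 1 ≡ n
sum-1 zero    = refl
sum-1 (suc n) = cong suc (sum-1 n)

sum-+ : ∀ m n (f : ℕ → ℕ) → ∑[ i < m + n ] f (toℕ i) ≡ ∑[ i < m ] f (toℕ i) + ∑[ i < n ] f (m + toℕ i)
sum-+ zero    n f = refl
sum-+ (suc m) n f = trans (cong (f 0 +_) (sum-+ m n (f ∘ suc))) (sym (+-assoc (f 0) _ _))

-- `k` and `m` may stand in either order: the lemma cuts a range of length `n` at `c + c`, and also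
-- passes from length `c` to length `n`.
sum-vanishing : ∀ k m (f : ℕ → ℕ) → (∀ d → m ≤ d → f d ≡ 0) → ∑[ d < k ] f (toℕ d) ≤ ∑[ d < m ] f (toℕ d)
sum-vanishing k       zero    f f≡0 = ≤-reflexive (sum-0 {k} (λ d → f≡0 (toℕ d) z≤n))
sum-vanishing zero    (suc m) f f≡0 = z≤n
sum-vanishing (suc k) (suc m) f f≡0 = +-monoʳ-≤ (f 0) (sum-vanishing k m (f ∘ suc) (λ d m≤d → f≡0 (suc d) (s≤s m≤d)))

m<n∸o⇒m+o<n : ∀ m o {n} → m < n ∸ o → m + o < n
m<n∸o⇒m+o<n m zero            m<n   = subst (_< _) (sym (+-identityʳ m)) m<n
m<n∸o⇒m+o<n m (suc o) {suc n} m<n∸o = subst (_< suc n) (sym (+-suc m o)) (s<s (m<n∸o⇒m+o<n m o m<n∸o))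

count-≥ : ∀ {P : Pred ℕ 0ℓ} (P? : Decidable P) j k → j ≤ k → (∀ t → t < j → P t) → j ≤ ∑[ t < k ] 𝟙 (P? (toℕ t))
count-≥ P? zero    k       j≤k       Pt = z≤n
count-≥ P? (suc j) (suc k) (s≤s j≤k) Pt =
  +-mono-≤ (≤-reflexive (sym (𝟙-yes (P? 0) (Pt 0 z<s)))) (count-≥ (P? ∘ suc) j k j≤k (λ t t<j → Pt (suc t) (s≤s t<j)))

sum-shift : ∀ k (g : ℕ → ℕ) → ∑[ t < k ] g (suc (toℕ t)) + g 0 ≡ ∑[ t < k ] g (toℕ t) + g k
sum-shift zero    g = refl
sum-shift (suc k) g = begin
  (g 1 + s₂) + g 0   ≡⟨ eq (g 1) s₂ (g 0) ⟩
  g 0 + (s₂ + g 1)   ≡⟨ cong (g 0 +_) (sum-shift k (g ∘ suc)) ⟩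
  g 0 + (s₁ + g (suc k)) ≡⟨ sym (+-assoc (g 0) _ _) ⟩
  (g 0 + s₁) + g (suc k) ∎
  where
  open ≡-Reasoning
  s₁ = ∑[ t < k ] g (suc (toℕ t))
  s₂ = ∑[ t < k ] g (suc (suc (toℕ t)))
  eq : ∀ x y z → (x + y) + z ≡ z + (y + x)
  eq = solve-∀

-- Induction on the shift. Raising `c` by one drops the term at `t = 0` and adds the one at `t = k`;
-- both have residue `c % k`, so they cancel.
sum-cyclic : ∀ k .{{_ : NonZero k}} (f : ℕ → ℕ) c → ∑[ t < k ] f ((c + toℕ t) % k) ≡ ∑[ t < k ] f (toℕ t)
sum-cyclic k f zero    = sum-cong-≗ (λ t → cong f (m<n⇒m%n≡m (Fin.toℕ<n t)))
sum-cyclic k f (suc c) = trans (+-cancelʳ-≡ (g 0) _ _ step) (sum-cyclic k f c)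
  where
  open ≡-Reasoning
  g : ℕ → ℕ
  g t = f ((c + t) % k)
  step : ∑[ t < k ] f ((suc c + toℕ t) % k) + g 0 ≡ ∑[ t < k ] g (toℕ t) + g 0
  step = begin
    ∑[ t < k ] f ((suc c + toℕ t) % k) + g 0
      ≡⟨ cong (_+ g 0) (sum-cong-≗ {k} (λ t → cong (λ m → f (m % k)) (sym (+-suc c (toℕ t))))) ⟩
    ∑[ t < k ] g (suc (toℕ t)) + g 0          ≡⟨ sum-shift k g ⟩
    ∑[ t < k ] g (toℕ t) + g k
      ≡⟨ cong (λ m → ∑[ t < k ] g (toℕ t) + f m) (trans ([m+n]%n≡m%n c k) (cong (_% k) (sym (+-identityʳ c)))) ⟩
    ∑[ t < k ] g (toℕ t) + g 0                ∎

-- Averaging: some term is at least the mean. This selects the translate with the most inversions.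
sum≤*max : ∀ k .{{_ : NonZero k}} (f : Fin k → ℕ) → ∃ λ t → sum f ≤ k * f t
sum≤*max (suc zero)        f = zero , ≤-refl
sum≤*max (suc k@(suc _)) f with sum≤*max k (f ∘ suc)
... | t , sum≤ with ≤-total (f zero) (f (suc t))
...   | inj₁ f0≤ft = suc t , +-mono-≤ f0≤ft sum≤
...   | inj₂ ft≤f0 = zero , +-monoʳ-≤ (f zero) (≤-trans sum≤ (*-monoʳ-≤ k ft≤f0))

-- The sum over j restricted to j ≥ i and reindexed by d = j − i.
sum-from : ∀ i k n (φ : ℕ → ℕ) → ∑[ d < k ] (𝟙 (i + toℕ d <? n) * φ (i + toℕ d)) ≤ ∑[ j < n ] φ (toℕ j)
sum-from i       k       zero    φ = ≤-reflexive (sum-0 {k} (λ d → cong (_* φ (i + toℕ d)) (𝟙-no (i + toℕ d <? 0) λ ())))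
sum-from zero    zero    (suc n) φ = z≤n
sum-from zero    (suc k) (suc n) φ = +-mono-≤ (≤-reflexive (*-identityˡ (φ 0))) (sum-from zero k n (φ ∘ suc))
sum-from (suc i) k       (suc n) φ = ≤-trans (sum-from i k n (φ ∘ suc)) (m≤n+m _ (φ 0))

-- Inversions as double sums, and permutations from rankings.

length-filter-tabulate : ∀ {A : Set} {P : Pred A 0ℓ} (P? : Decidable P) {n} (f : Fin n → A) →
  length (filter P? (List.tabulate f)) ≡ ∑[ i < n ] 𝟙 (P? (f i))
length-filter-tabulate P? {zero}  f = refl
length-filter-tabulate P? {suc n} f with does (P? (f zero))
... | true  = cong suc (length-filter-tabulate P? (f ∘ suc))
... | false = length-filter-tabulate P? (f ∘ suc)

length-filter-cartesianProduct : ∀ {A B : Set} {P : Pred (A × B) 0ℓ} (P? : Decidable P) {m n} (f : Fin m → A) (g : Fin n → B) →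
  length (filter P? (cartesianProduct (List.tabulate f) (List.tabulate g))) ≡ ∑[ i < m ] ∑[ j < n ] 𝟙 (P? (f i , g j))
length-filter-cartesianProduct P? {zero}  f g = refl
length-filter-cartesianProduct P? {suc m} {n} f g = begin
  length (filter P? (row ++ rest))                   ≡⟨ cong length (List.filter-++ P? row rest) ⟩
  length (filter P? row ++ filter P? rest)           ≡⟨ List.length-++ (filter P? row) ⟩
  length (filter P? row) + length (filter P? rest)   ≡⟨ cong₂ _+_ row≡ (length-filter-cartesianProduct P? (f ∘ suc) g) ⟩
  ∑[ i < suc m ] ∑[ j < n ] 𝟙 (P? (f i , g j))       ∎
  where
  open ≡-Reasoning
  row  = map (f zero ,_) (List.tabulate g)
  rest = cartesianProduct (List.tabulate (f ∘ suc)) (List.tabulate g)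
  row≡ : length (filter P? row) ≡ ∑[ j < n ] 𝟙 (P? (f zero , g j))
  row≡ = trans (cong (length ∘ filter P?) (List.map-tabulate g (f zero ,_))) (length-filter-tabulate P? (λ j → f zero , g j))

sum-map-filter : ∀ {P : Pred ℕ 0ℓ} (P? : Decidable P) (g f : ℕ → ℕ) n →
  ℕ.sum (map g (filter P? (applyUpTo f n))) ≡ ∑[ i < n ] (𝟙 (P? (f (toℕ i))) * g (f (toℕ i)))
sum-map-filter P? g f zero = refl
sum-map-filter P? g f (suc n) with does (P? (f 0))
... | true  = cong₂ _+_ (sym (*-identityˡ (g (f 0)))) (sum-map-filter P? g (f ∘ suc) n)
... | false = sum-map-filter P? g (f ∘ suc) n

inversions-∑ : ∀ {n} (x : Array n) → inversions x ≡ ∑[ i < n ] ∑[ j < n ] 𝟙 (inversion? x (i , j))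
inversions-∑ x = length-filter-cartesianProduct (inversion? x) id id

-- If a value were missed, punching it out of the codomain would inject a finite set into a smaller
-- one.
injective⇒permutation : ∀ {n} (f : Fin n → Fin n) → (∀ {i j} → f i ≡ f j → i ≡ j) →
  Σ[ π ∈ Permutation′ n ] (∀ i → π ⟨$⟩ʳ i ≡ f i)
injective⇒permutation {n} f f-injective =
  Perm.permutation f (proj₁ ∘ preimage) (proj₂ ∘ preimage) (λ i → f-injective (proj₂ (preimage (f i)))) , λ _ → refl
  where
  missed : ∀ {n} (f : Fin n → Fin n) → (∀ {i j} → f i ≡ f j → i ≡ j) → ∀ k → ¬ (∀ i → k ≢ f i)
  missed {suc n} f f-inj k k∉f = 1+n≰n (Fin.injective⇒≤ {f = λ i → punchOut (k∉f i)}
    (λ eq → f-inj (Fin.punchOut-injective (k∉f _) (k∉f _) eq)))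
  preimage : ∀ k → ∃ λ i → f i ≡ k
  preimage k with Fin.any? (λ i → f i Fin.≟ k)
  ... | yes p = p
  ... | no ¬p = ⊥-elim (missed f f-injective k (λ i k≡fi → ¬p (i , sym k≡fi)))

-- Each index goes to the number of indices with a smaller key. An index never counts itself, so
-- ranks stay below `n`; for the same reason a smaller key has a strictly smaller rank, and ranks
-- are distinct because keys are.
ranking : ∀ {n} (κ : Fin n → ℕ) → (∀ {i j} → κ i ≡ κ j → i ≡ j) →
  Σ[ π ∈ Permutation′ n ] (∀ i j → κ i < κ j → π ⟨$⟩ʳ i Fin.< π ⟨$⟩ʳ j)
ranking {n} κ κ-injective = proj₁ perm , mono
  where
  rank : Fin n → ℕ
  rank i = ∑[ j < n ] 𝟙 (κ j <? κ i)
  rank<n : ∀ i → rank i < n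
  rank<n i = subst (rank i <_) (sum-1 n) (sum-mono-< (λ j → 𝟙≤1 (κ j <? κ i)) i
    (≤-reflexive (cong suc (𝟙-no (κ i <? κ i) (<-irrefl refl)))))
  rank-mono : ∀ {i j} → κ i < κ j → rank i < rank j
  rank-mono {i} {j} κi<κj = sum-mono-< (λ l → 𝟙-mono (κ l <? κ i) (κ l <? κ j) (λ κl<κi → <-trans κl<κi κi<κj)) i
    (subst₂ _<_ (sym (𝟙-no (κ i <? κ i) (<-irrefl refl))) (sym (𝟙-yes (κ i <? κ j) κi<κj)) z<s)
  rank-injective : ∀ {i j} → rank i ≡ rank j → i ≡ j
  rank-injective {i} {j} eq with <-cmp (κ i) (κ j)
  ... | tri< lt _ _ = contradiction eq (<⇒≢ (rank-mono lt))
  ... | tri≈ _ κi≡κj _ = κ-injective κi≡κj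
  ... | tri> _ _ gt = contradiction (sym eq) (<⇒≢ (rank-mono gt))
  perm = injective⇒permutation (λ i → fromℕ< (rank<n i)) (λ eq → rank-injective (Fin.fromℕ<-injective _ _ _ _ eq))
  toℕ-perm : ∀ i → toℕ (proj₁ perm ⟨$⟩ʳ i) ≡ rank i
  toℕ-perm i = trans (cong toℕ (proj₂ perm i)) (Fin.toℕ-fromℕ< (rank<n i))
  mono : ∀ i j → κ i < κ j → proj₁ perm ⟨$⟩ʳ i Fin.< proj₁ perm ⟨$⟩ʳ j
  mono i j lt = subst₂ _<_ (sym (toℕ-perm i)) (sym (toℕ-perm j)) (rank-mono lt)

-- Coordinates with respect to two coprime integers, and their lexicographic order.

module Coordinates (a b : ℕ) (a≥2 : a ≥ 2) (a⊥b : Coprime a b) where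

  open import Data.Nat.Base using (_/_)

  private instance
    a≢0 : NonZero a
    a≢0 = >-nonZero (<-trans z<s a≥2)

  abstract
    inverse : ∃₂ λ b⁻¹ k → b⁻¹ * b ≡ 1 + k * a
    inverse = go a≥2 (coprime-Bézout a⊥b)
      where
      go : ∀ {a} → a ≥ 2 → Bézout.Identity 1 a b → ∃₂ λ b⁻¹ k → b⁻¹ * b ≡ 1 + k * a
      go _ (Bézout.-+ x y eq) = y , x , sym eq
      go {suc zero} (s≤s ()) _
      -- Here `y * b` is -1 modulo `a`, so multiplying `y` by `a − 1` gives an inverse of `b`.
      go {a@(suc a′@(suc _))} _ (Bézout.+- (suc x) y eq) = y * a′ , x * a′ + pred a′ , +-cancelʳ-≡ a′ _ _ (begin
        y * a′ * b + a′                    ≡⟨ lhs y a′ b ⟩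
        (1 + y * b) * a′                   ≡⟨ cong (_* a′) eq ⟩
        suc x * a * a′                     ≡⟨ rhs x (pred a′) ⟩
        1 + (x * a′ + pred a′) * a + a′    ∎)
        where
        open ≡-Reasoning
        lhs : ∀ y c b → y * c * b + c ≡ (1 + y * b) * c
        lhs = solve-∀
        rhs : ∀ x c → suc x * suc (suc c) * suc c ≡ 1 + (x * suc c + c) * suc (suc c) + suc c
        rhs = solve-∀

    -- Adding a * b makes the first coordinate of every m a natural number.
    coordinates : ∀ m → ∃₂ λ x y → y < a × m + a * b ≡ x * a + y * b
    coordinates m with inverse
    ... | b⁻¹ , k , b⁻¹b≡1+ka =
      -- Modulo `a`, the second coordinate has to be `m` times the inverse of `b`. The subtraction
      -- does not truncate, by `mk≤`; this is where the added `a * b` is spent, against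
      -- `y * b ≤ a * b`.
      q * b + b ∸ m * k , y , m%n<n (m * b⁻¹) a , +-cancelʳ-≡ (m * k * a) _ _ (trans shifted (sym restored))
      where
      open ≡-Reasoning
      y q : ℕ
      y = (m * b⁻¹) % a
      q = (m * b⁻¹) / a
      lhs : ∀ m k a b → m + a * b + m * k * a ≡ m * (1 + k * a) + a * b
      lhs = solve-∀
      rhs : ∀ y q a b → (y + q * a) * b + a * b ≡ y * b + (q * b + b) * a
      rhs = solve-∀
      shifted : m + a * b + m * k * a ≡ y * b + (q * b + b) * a
      shifted = begin
        m + a * b + m * k * a        ≡⟨ lhs m k a b ⟩
        m * (1 + k * a) + a * b      ≡⟨ cong (λ c → m * c + a * b) b⁻¹b≡1+ka ⟨
        m * (b⁻¹ * b) + a * b        ≡⟨ cong (_+ a * b) (*-assoc m b⁻¹ b) ⟨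
        m * b⁻¹ * b + a * b          ≡⟨ cong (λ c → c * b + a * b) (m≡m%n+[m/n]*n (m * b⁻¹) a) ⟩
        (y + q * a) * b + a * b      ≡⟨ rhs y q a b ⟩
        y * b + (q * b + b) * a      ∎
      mk≤ : m * k ≤ q * b + b
      mk≤ = *-cancelʳ-≤ (m * k) (q * b + b) a (+-cancelˡ-≤ (y * b) _ _
        (≤-trans (+-monoˡ-≤ (m * k * a) (≤-trans (*-monoˡ-≤ b (<⇒≤ (m%n<n (m * b⁻¹) a))) (m≤n+m (a * b) m)))
                 (≤-reflexive shifted)))
      restored : (q * b + b ∸ m * k) * a + y * b + m * k * a ≡ y * b + (q * b + b) * a
      restored = begin
        (q * b + b ∸ m * k) * a + y * b + m * k * a   ≡⟨ eq (q * b + b ∸ m * k) a (y * b) (m * k) ⟩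
        y * b + (q * b + b ∸ m * k + m * k) * a       ≡⟨ cong (λ c → y * b + c * a) (m∸n+n≡m mk≤) ⟩
        y * b + (q * b + b) * a                       ∎
        where
        eq : ∀ x a w v → x * a + w + v * a ≡ w + (x + v) * a
        eq = solve-∀

  private
    -- With `e = y′ − y`, equality of the two sums makes `a` divide `b * e`, hence `e` by
    -- coprimality. As `e < a`, this forces `e = 0`.
    unique-≤ : ∀ x x′ y y′ → y ≤ y′ → y′ < a → x * a + y * b ≡ x′ * a + y′ * b → y ≡ y′
    unique-≤ x x′ y y′ y≤y′ y′<a eq with m≤n⇒∃[o]m+o≡n y≤y′
    ... | 0           , refl = sym (+-identityʳ y)
    ... | e@(suc _)   , refl = contradiction (∣⇒≤ (coprime-divisor a⊥b a∣be)) (<⇒≱ (≤-<-trans (m≤n+m e y) y′<a))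
      where
      expand : ∀ x y e → x * a + (y + e) * b ≡ (x * a + b * e) + y * b
      expand x y e = identity x y e a b
        where
        identity : ∀ x y e a b → x * a + (y + e) * b ≡ (x * a + b * e) + y * b
        identity = solve-∀
      xa≡ : x * a ≡ x′ * a + b * e
      xa≡ = +-cancelʳ-≡ (y * b) _ _ (trans eq (expand x′ y e))
      a∣be : a ∣ b * e
      a∣be = divides (x ∸ x′) (begin
        b * e                      ≡⟨ m+n∸m≡n (x′ * a) (b * e) ⟨
        x′ * a + b * e ∸ x′ * a    ≡⟨ cong (_∸ x′ * a) xa≡ ⟨
        x * a ∸ x′ * a             ≡⟨ *-distribʳ-∸ a x x′ ⟨
        (x ∸ x′) * a               ∎)
        where open ≡-Reasoning

  unique : ∀ x x′ y y′ → y < a → y′ < a → x * a + y * b ≡ x′ * a + y′ * b → x ≡ x′ × y ≡ y′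
  unique x x′ y y′ y<a y′<a eq = x≡x′ , y≡y′
    where
    y≡y′ : y ≡ y′
    y≡y′ with ≤-total y y′
    ... | inj₁ y≤y′ = unique-≤ x x′ y y′ y≤y′ y′<a eq
    ... | inj₂ y′≤y = sym (unique-≤ x′ x y′ y y′≤y y<a (sym eq))
    x≡x′ = *-cancelʳ-≡ x x′ a (+-cancelʳ-≡ (y * b) _ _ (trans eq (cong (λ c → x′ * a + c * b) (sym y≡y′))))

  X Y : ℕ → ℕ
  X m = proj₁ (coordinates m)
  Y m = proj₁ (proj₂ (coordinates m))

  Y<a : ∀ m → Y m < a
  Y<a m = proj₁ (proj₂ (proj₂ (coordinates m)))

  XY-spec : ∀ m → m + a * b ≡ X m * a + Y m * b
  XY-spec m = proj₂ (proj₂ (proj₂ (coordinates m)))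

  XY-unique : ∀ m {x y} → y < a → m + a * b ≡ x * a + y * b → X m ≡ x × Y m ≡ y
  XY-unique m {x} {y} y<a eq = unique (X m) x (Y m) y (Y<a m) y<a (trans (sym (XY-spec m)) eq)

  -- Since Y < a, this encodes the lexicographic order of (X , Y).
  key : ℕ → ℕ
  key m = Y m + X m * a

  key-injective : ∀ {m m′} → key m ≡ key m′ → m ≡ m′
  key-injective {m} {m′} eq = +-cancelʳ-≡ (a * b) m m′
    (trans (XY-spec m) (trans (cong₂ (λ x y → x * a + y * b) X≡ Y≡) (sym (XY-spec m′))))
    where
    Y≡%  : ∀ m → key m % a ≡ Y m
    Y≡% m = trans ([m+kn]%n≡m%n (Y m) (X m) a) (m<n⇒m%n≡m (Y<a m))
    Y≡ : Y m ≡ Y m′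
    Y≡ = trans (sym (Y≡% m)) (trans (cong (_% a) eq) (Y≡% m′))
    X≡ : X m ≡ X m′
    X≡ = *-cancelʳ-≡ _ _ a (+-cancelˡ-≡ (Y m) _ _ (trans eq (cong (_+ X m′ * a) (sym Y≡))))

  X<⇒key< : ∀ {m m′} → X m < X m′ → key m < key m′
  X<⇒key< {m} {m′} X< = <-≤-trans (+-monoˡ-< (X m * a) (Y<a m)) (≤-trans (*-monoˡ-≤ a X<) (m≤n+m (X m′ * a) (Y m′)))

  key-+a : ∀ m → key m < key (m + a)
  key-+a m = X<⇒key< (≤-reflexive (sym (proj₁ (XY-unique (m + a) (Y<a m)
    (trans (lhs m a b) (trans (cong (_+ a) (XY-spec m)) (rhs (X m) (Y m) a b)))))))
    where
    lhs : ∀ m a b → m + a + a * b ≡ m + a * b + a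
    lhs = solve-∀
    rhs : ∀ x y a b → x * a + y * b + a ≡ suc x * a + y * b
    rhs = solve-∀

  -- Addition with carry: `t` is added to `Y`, and each time `Y` passes `a`, the product `a * b`
  -- moves to the other summand and raises `X` by `b`.
  XY-+tb : ∀ m t → X (m + t * b) ≡ X m + (Y m + t) / a * b × Y (m + t * b) ≡ (Y m + t) % a
  XY-+tb m t = XY-unique (m + t * b) (m%n<n (Y m + t) a) (begin
    m + t * b + a * b                 ≡⟨ lhs m t a b ⟩
    m + a * b + t * b                 ≡⟨ cong (_+ t * b) (XY-spec m) ⟩
    X m * a + Y m * b + t * b         ≡⟨ mid (X m) (Y m) t a b ⟩
    X m * a + (Y m + t) * b           ≡⟨ cong (λ c → X m * a + c * b) (m≡m%n+[m/n]*n (Y m + t) a) ⟩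
    X m * a + (r + q * a) * b         ≡⟨ rhs (X m) r q a b ⟩
    (X m + q * b) * a + r * b         ∎)
    where
    open ≡-Reasoning
    r = (Y m + t) % a
    q = (Y m + t) / a
    lhs : ∀ m t a b → m + t * b + a * b ≡ m + a * b + t * b
    lhs = solve-∀
    mid : ∀ x y t a b → x * a + y * b + t * b ≡ x * a + (y + t) * b
    mid = solve-∀
    rhs : ∀ x r q a b → x * a + (r + q * a) * b ≡ (x + q * b) * a + r * b
    rhs = solve-∀

  -- Either `Y` grows by one and `X` stays, or `Y` wraps around and the carry raises `X` by at least
  -- `b`.
  key-+b : b ≥ 1 → ∀ m → key m < key (m + b)
  key-+b b≥1 m with XY-+tb m 1 | suc (Y m) <? a
  ... | X≡ , Y≡ | yes 1+Y<a = begin-strict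
      key m                               <⟨ n<1+n (key m) ⟩
      suc (Y m) + X m * a                 ≡⟨ cong₂ (λ x y → y + x * a) (sym X+b) (sym Y+b) ⟩
      key (m + b)                         ∎
    where
    open ≤-Reasoning
    Y+1<a : Y m + 1 < a
    Y+1<a = subst (_< a) (+-comm 1 (Y m)) 1+Y<a
    m+1*b : m + 1 * b ≡ m + b
    m+1*b = cong (m +_) (*-identityˡ b)
    X+b : X (m + b) ≡ X m
    X+b = trans (cong X (sym m+1*b)) (trans X≡ (trans (cong (λ q → X m + q * b) (m<n⇒m/n≡0 Y+1<a)) (+-identityʳ (X m))))
    Y+b : Y (m + b) ≡ suc (Y m)
    Y+b = trans (cong Y (sym m+1*b)) (trans Y≡ (trans (m<n⇒m%n≡m Y+1<a) (+-comm (Y m) 1)))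
  ... | X≡ , Y≡ | no 1+Y≮a = X<⇒key< (begin-strict
      X m                     <⟨ m<m+n (X m) b≥1 ⟩
      X m + b                 ≡⟨ cong (X m +_) (*-identityˡ b) ⟨
      X m + 1 * b             ≤⟨ +-monoʳ-≤ (X m) (*-monoˡ-≤ b (m≥n⇒m/n>0 (subst (a ≤_) (+-comm 1 (Y m)) (≮⇒≥ 1+Y≮a)))) ⟩
      X m + (Y m + 1) / a * b ≡⟨ X≡ ⟨
      X (m + 1 * b)           ≡⟨ cong (λ c → X (m + c)) (*-identityˡ b) ⟩
      X (m + b)               ∎)
    where open ≤-Reasoning

  key-mono : b ≥ 1 → ∀ m {d} → ⟨ a , b ⟩ d → key m ≤ key (m + d)
  key-mono b≥1 m (x , y , refl) = subst (λ c → key m ≤ key c) (+-assoc m (x * a) (y * b))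
    (≤-trans (steps-a x) (steps-b (m + x * a) y))
    where
    steps-a : ∀ x → key m ≤ key (m + x * a)
    steps-a zero    = ≤-reflexive (cong key (sym (+-identityʳ m)))
    steps-a (suc x) = ≤-trans (steps-a x) (≤-trans (<⇒≤ (key-+a (m + x * a))) (≤-reflexive (cong key (eq m (x * a) a))))
      where
      eq : ∀ m c d → m + c + d ≡ m + (d + c)
      eq = solve-∀
    steps-b : ∀ m y → key m ≤ key (m + y * b)
    steps-b m zero    = ≤-reflexive (cong key (sym (+-identityʳ m)))
    steps-b m (suc y) = ≤-trans (<⇒≤ (key-+b b≥1 m)) (≤-trans (steps-b (m + b) y) (≤-reflexive (cong key (+-assoc m b (y * b)))))

  -- If `X d ≥ b`, the added `a * b` can be taken back from the first summand, leaving a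
  -- representation of `d` with natural coefficients.
  gap⇒X<b : ∀ {d} → ¬ ⟨ a , b ⟩ d → X d < b
  gap⇒X<b {d} d∉ with X d <? b
  ... | yes X<b = X<b
  ... | no X≮b = contradiction (X d ∸ b , Y d , +-cancelʳ-≡ (a * b) _ _ (begin
      (X d ∸ b) * a + Y d * b + a * b    ≡⟨ eq (X d ∸ b) (Y d) a b ⟩
      (X d ∸ b + b) * a + Y d * b        ≡⟨ cong (λ c → c * a + Y d * b) (m∸n+n≡m (≮⇒≥ X≮b)) ⟩
      X d * a + Y d * b                  ≡⟨ XY-spec d ⟨
      d + a * b                          ∎)) d∉
    where
    open ≡-Reasoning
    eq : ∀ x y a b → x * a + y * b + a * b ≡ (x + b) * a + y * b
    eq = solve-∀

  -- The hypothesis on `Y` rules out a carry, so `X (m + d) = X m + X d − b`, and this is less than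
  -- `X m` because `X d < b` for a gap.
  gap-reversed : ∀ {d} → ¬ ⟨ a , b ⟩ d → ∀ m → Y m + Y d < a → key (m + d) < key m
  gap-reversed {d} d∉ m Y< = X<⇒key< (+-cancelʳ-< b _ _ (subst (_< X m + b) (sym X+b) (+-monoʳ-< (X m) (gap⇒X<b d∉))))
    where
    expand : ∀ m d a b → (m + d + a * b) + a * b ≡ (m + a * b) + (d + a * b)
    expand = solve-∀
    collect : ∀ x y x′ y′ a b → (x * a + y * b) + (x′ * a + y′ * b) ≡ (x + x′) * a + (y + y′) * b
    collect = solve-∀
    total : (m + d + a * b) + a * b ≡ (X m + X d) * a + (Y m + Y d) * b
    total = trans (expand m d a b) (trans (cong₂ _+_ (XY-spec m) (XY-spec d)) (collect (X m) (Y m) (X d) (Y d) a b))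
    -- By `total`, `X m + X d` and `Y m + Y d` represent a number that is at least `2ab`. The second
    -- summand contributes at most `ab`, so the first contributes at least `ab`.
    b≤ : b ≤ X m + X d
    b≤ = *-cancelʳ-≤ b (X m + X d) a (+-cancelʳ-≤ (a * b) _ _ (begin
      b * a + a * b                               ≡⟨ cong (_+ a * b) (*-comm b a) ⟩
      a * b + a * b                               ≤⟨ +-monoˡ-≤ (a * b) (m≤n+m (a * b) (m + d)) ⟩
      (m + d + a * b) + a * b                     ≡⟨ total ⟩
      (X m + X d) * a + (Y m + Y d) * b           ≤⟨ +-monoʳ-≤ ((X m + X d) * a) (*-monoˡ-≤ b (<⇒≤ Y<)) ⟩
      (X m + X d) * a + a * b                     ∎))
      where open ≤-Reasoning
    X≡ : X (m + d) ≡ X m + X d ∸ b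
    X≡ = proj₁ (XY-unique (m + d) Y< (+-cancelʳ-≡ (a * b) _ _ (begin
      m + d + a * b + a * b                             ≡⟨ total ⟩
      (X m + X d) * a + (Y m + Y d) * b                 ≡⟨ cong (λ c → c * a + (Y m + Y d) * b) (m∸n+n≡m b≤) ⟨
      (X m + X d ∸ b + b) * a + (Y m + Y d) * b         ≡⟨ eq (X m + X d ∸ b) (Y m + Y d) a b ⟩
      (X m + X d ∸ b) * a + (Y m + Y d) * b + a * b     ∎)))
      where
      open ≡-Reasoning
      eq : ∀ x y a b → (x + b) * a + y * b ≡ x * a + y * b + a * b
      eq = solve-∀
    X+b : X (m + d) + b ≡ X m + X d
    X+b = trans (cong (_+ b) X≡) (m∸n+n≡m b≤)

  -- Y (i + t * b) = (Y i + t) % a runs over all residues below a, each once.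
  gap-reversals : ∀ {d} → ¬ ⟨ a , b ⟩ d → ∀ i →
    a ∸ Y d ≤ ∑[ t < a ] 𝟙 (key (i + d + toℕ t * b) <? key (i + toℕ t * b))
  gap-reversals {d} d∉ i = begin
    a ∸ Y d
      ≤⟨ count-≥ (λ t → t + Y d <? a) (a ∸ Y d) a (m∸n≤m a (Y d)) (λ t → m<n∸o⇒m+o<n t (Y d)) ⟩
    ∑[ t < a ] 𝟙 (toℕ t + Y d <? a)                              ≡⟨ sum-cyclic a (λ t → 𝟙 (t + Y d <? a)) (Y i) ⟨
    ∑[ t < a ] 𝟙 ((Y i + toℕ t) % a + Y d <? a)
      ≤⟨ sum-mono-≤ {a} (λ t → 𝟙-mono (_ <? a) (key (i + d + toℕ t * b) <? key (i + toℕ t * b)) (reversed (toℕ t))) ⟩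
    ∑[ t < a ] 𝟙 (key (i + d + toℕ t * b) <? key (i + toℕ t * b)) ∎
    where
    open ≤-Reasoning
    swap : ∀ i d c → i + c + d ≡ i + d + c
    swap = solve-∀
    reversed : ∀ t → (Y i + t) % a + Y d < a → key (i + d + t * b) < key (i + t * b)
    reversed t lt = subst (λ c → key c < key (i + t * b)) (swap i d (t * b))
      (gap-reversed d∉ (i + t * b) (subst (λ y → y + Y d < a) (sym (proj₂ (XY-+tb i t))) lt))

-- Averaging inversions over the translates of the order.

open Coordinates using (X; Y)

module _ (a b : ℕ) (a≥2 : a ≥ 2) (b≥2 : b ≥ 2) (a⊥b : Coprime a b) where
  open Coordinates a b a≥2 a⊥b hiding (X; Y)
  private instance
    a≢0 : NonZero a
    a≢0 = >-nonZero (<-trans z<s a≥2)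

  -- `G` is a decidable set of gaps, so that indicators can be summed over it. Each translate of the
  -- order yields one permutation, and the left-hand sum bounds from below the inversions of all `a`
  -- of them together; the best one is returned.
  lexicographic-permutation : ∀ {G : Pred ℕ 0ℓ} (G? : Decidable G) → (∀ {d} → G d → ¬ ⟨ a , b ⟩ d) → ∀ n →
    Σ[ π ∈ Permutation′ n ] (∀ d → ⟨ a , b ⟩ d → Sorted d (array π)) ×
      (∑[ d < n ] (𝟙 (G? (toℕ d)) * (n ∸ toℕ d) * (a ∸ Y a b a≥2 a⊥b (toℕ d))) ≤ a * inversions (array π))
  lexicographic-permutation {G} G? G⇒gap n = π t* , sorted t* , ≤-trans double-count (proj₂ best)
    where
    κ : Fin a → Fin n → ℕ
    κ t i = key (toℕ i + toℕ t * b)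
    κ-ranking = λ t → ranking (κ t) (λ eq → Fin.toℕ-injective (+-cancelʳ-≡ (toℕ t * b) _ _ (key-injective eq)))
    π : Fin a → Permutation′ n
    π t = proj₁ (κ-ranking t)
    best = sum≤*max a (inversions ∘ array ∘ π)
    t* = proj₁ best
    lookup-π : ∀ t i → π t ⟨$⟩ʳ i ≡ lookup (array (π t)) i
    lookup-π t i = sym (Vec.lookup∘tabulate (π t ⟨$⟩ʳ_) i)

    sorted : ∀ t d → ⟨ a , b ⟩ d → Sorted d (array (π t))
    sorted t d d∈ i j j≡i+d = subst₂ Fin._≤_ (lookup-π t i) (lookup-π t j) π≤
      where
      swap : ∀ i d c → i + c + d ≡ i + d + c
      swap = solve-∀
      κ≤ : κ t i ≤ κ t j
      κ≤ = subst (λ c → κ t i ≤ key c) (trans (swap (toℕ i) d (toℕ t * b)) (cong (_+ toℕ t * b) (sym j≡i+d)))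
        (key-mono (<⇒≤ b≥2) _ d∈)
      π≤ : π t ⟨$⟩ʳ i Fin.≤ π t ⟨$⟩ʳ j
      π≤ with m≤n⇒m<n∨m≡n κ≤
      ... | inj₁ κ< = <⇒≤ (proj₂ (κ-ranking t) i j κ<)
      -- Equal keys mean equal positions. This is the case `d = 0`, which belongs to `⟨ a , b ⟩`.
      ... | inj₂ κ≡ = ≤-reflexive (cong (λ k → toℕ (π t ⟨$⟩ʳ k)) (Fin.toℕ-injective (+-cancelʳ-≡ (toℕ t * b) _ _ (key-injective κ≡))))

    Reversed? : ∀ i t j → Dec (i < j × key (j + t * b) < key (i + t * b))
    Reversed? i t j = (i <? j) ×-dec (key (j + t * b) <? key (i + t * b))

    reversed≤inversions : ∀ t →
      ∑[ i < n ] ∑[ d < n ] (𝟙 (toℕ i + toℕ d <? n) * 𝟙 (Reversed? (toℕ i) (toℕ t) (toℕ i + toℕ d))) ≤ inversions (array (π t))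
    reversed≤inversions t = ≤-trans
      (sum-mono-≤ {n} (λ i → ≤-trans (sum-from (toℕ i) n n (λ j → 𝟙 (Reversed? (toℕ i) (toℕ t) j)))
        (sum-mono-≤ {n} (λ j → 𝟙-mono (Reversed? (toℕ i) (toℕ t) (toℕ j)) (inversion? (array (π t)) (i , j))
          (λ (i<j , κ<) → i<j , subst₂ Fin._<_ (lookup-π t j) (lookup-π t i) (proj₂ (κ-ranking t) j i κ<))))))
      (≤-reflexive (sym (inversions-∑ (array (π t)))))

    gap-weight : ∀ i d → 𝟙 (G? d) * (a ∸ Y a b a≥2 a⊥b d) ≤ ∑[ t < a ] 𝟙 (Reversed? i (toℕ t) (i + d))
    gap-weight i d with G? d
    ... | no _ = z≤n
    ... | yes Gd = ≤-trans (≤-reflexive (*-identityˡ _)) (≤-trans (gap-reversals (G⇒gap Gd) i)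
          (sum-mono-≤ {a} (λ t → 𝟙-mono (_ <? _) (Reversed? i (toℕ t) (i + d)) (m<m+n i (d>0 Gd) ,_))))
      where
      -- An inversion needs `i < i + d`; the distance 0 is no gap.
      d>0 : ∀ {d} → G d → d > 0
      d>0 {zero}  G0 = contradiction (0 , 0 , refl) (G⇒gap G0)
      d>0 {suc d} _  = z<s

    pairs-at-distance : ∀ d → n ∸ d ≤ ∑[ i < n ] 𝟙 (toℕ i + d <? n)
    pairs-at-distance d = count-≥ (λ i → i + d <? n) (n ∸ d) n (m∸n≤m n d) (λ i → m<n∸o⇒m+o<n i d)

    double-count : ∑[ d < n ] (𝟙 (G? (toℕ d)) * (n ∸ toℕ d) * (a ∸ Y a b a≥2 a⊥b (toℕ d))) ≤ ∑[ t < a ] inversions (array (π t))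
    double-count = begin
      ∑[ d < n ] (𝟙 (G? (toℕ d)) * (n ∸ toℕ d) * (a ∸ Y a b a≥2 a⊥b (toℕ d)))
        ≡⟨ sum-cong-≗ {n} (λ d → eq (𝟙 (G? (toℕ d))) (n ∸ toℕ d) (a ∸ Y a b a≥2 a⊥b (toℕ d))) ⟩
      ∑[ d < n ] ((n ∸ toℕ d) * v (toℕ d))
        -- The weight `n − d` is spread over the starting positions `i` of pairs at distance `d`, so
        -- that the sums can be interchanged and the one over translates brought outside.
        ≤⟨ sum-mono-≤ {n} (λ d → *-monoˡ-≤ (v (toℕ d)) (pairs-at-distance (toℕ d))) ⟩
      ∑[ d < n ] ((∑[ i < n ] 𝟙 (toℕ i + toℕ d <? n)) * v (toℕ d))
        ≡⟨ sum-cong-≗ {n} (λ d → *-distribʳ-sum {n} (v (toℕ d)) (λ i → 𝟙 (toℕ i + toℕ d <? n))) ⟩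
      ∑[ d < n ] ∑[ i < n ] (𝟙 (toℕ i + toℕ d <? n) * v (toℕ d))
        ≤⟨ sum-mono-≤ {n} (λ d → sum-mono-≤ {n} (λ i → *-monoʳ-≤ (𝟙 (toℕ i + toℕ d <? n)) (gap-weight (toℕ i) (toℕ d)))) ⟩
      ∑[ d < n ] ∑[ i < n ] (𝟙 (toℕ i + toℕ d <? n) * ∑[ t < a ] R i d t)
        ≡⟨ sum-cong-≗ {n} (λ d → sum-cong-≗ {n} (λ i → *-distribˡ-sum {a} (𝟙 (toℕ i + toℕ d <? n)) (R i d))) ⟩
      ∑[ d < n ] ∑[ i < n ] ∑[ t < a ] (𝟙 (toℕ i + toℕ d <? n) * R i d t)
        ≡⟨ ∑-comm {n} {n} (λ d i → ∑[ t < a ] (𝟙 (toℕ i + toℕ d <? n) * R i d t)) ⟩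
      ∑[ i < n ] ∑[ d < n ] ∑[ t < a ] (𝟙 (toℕ i + toℕ d <? n) * R i d t)
        ≡⟨ sum-cong-≗ {n} (λ i → ∑-comm {n} {a} (λ d t → 𝟙 (toℕ i + toℕ d <? n) * R i d t)) ⟩
      ∑[ i < n ] ∑[ t < a ] ∑[ d < n ] (𝟙 (toℕ i + toℕ d <? n) * R i d t)
        ≡⟨ ∑-comm {n} {a} (λ i t → ∑[ d < n ] (𝟙 (toℕ i + toℕ d <? n) * R i d t)) ⟩
      ∑[ t < a ] ∑[ i < n ] ∑[ d < n ] (𝟙 (toℕ i + toℕ d <? n) * R i d t)
        ≤⟨ sum-mono-≤ {a} reversed≤inversions ⟩
      ∑[ t < a ] inversions (array (π t)) ∎
      where
      open ≤-Reasoning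
      v : ℕ → ℕ
      v d = 𝟙 (G? d) * (a ∸ Y a b a≥2 a⊥b d)
      R : Fin n → Fin n → Fin a → ℕ
      R i d t = 𝟙 (Reversed? (toℕ i) (toℕ t) (toℕ i + toℕ d))
      eq : ∀ g w y → g * w * y ≡ w * (g * y)
      eq = solve-∀

-- Bounding the gap weights, and combining the two lexicographic orders.

module _ (a b : ℕ) (a≥2 : a ≥ 2) (b≥2 : b ≥ 2) (a⊥b : Coprime a b)
  {G : Pred ℕ 0ℓ} (G? : Decidable G) (G⇒gap : ∀ {d} → G d → ¬ ⟨ a , b ⟩ d) (gap⇒G : ∀ {d} → ¬ ⟨ a , b ⟩ d → G d)
  (n : ℕ) where

  private
    module AB = Coordinates a b a≥2 a⊥b
    module BA = Coordinates b a b≥2 (Coprime.sym a⊥b)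

    w : ℕ → ℕ
    w d = 𝟙 (G? d) * (n ∸ d)

    A-spec : ∀ d → d + a * b ≡ AB.X d * a + AB.Y d * b
    A-spec = AB.XY-spec

    instance
      a≢0 : NonZero a
      a≢0 = >-nonZero (<-trans z<s a≥2)
      b≢0 : NonZero b
      b≢0 = >-nonZero (<-trans z<s b≥2)

  -- For a gap `X < b`, so the pair read backwards meets the size condition for coordinates with `a`
  -- and `b` exchanged; uniqueness does the rest.
  coordinates-swap : ∀ {d} → G d → BA.Y d ≡ AB.X d
  coordinates-swap {d} Gd = proj₂ (BA.XY-unique d {AB.Y d} {AB.X d} (AB.gap⇒X<b (G⇒gap Gd))
    (trans (cong (d +_) (*-comm b a)) (trans (A-spec d) (+-comm (AB.X d * a) (AB.Y d * b)))))

  -- For a gap, `d + ab = Xa + Yb` gives `(a − Y)b + (b − X)a = ab − d`: the identity of fractions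
  -- with denominators cleared. Other `d` have weight 0.
  complement-weights : ∀ d → w d * (a * b ∸ d) ≤ w d * (a ∸ AB.Y d) * b + w d * (b ∸ BA.Y d) * a
  complement-weights d with G? d
  ... | no _ = z≤n
  ... | yes Gd = ≤-trans
      (*-monoʳ-≤ u (≤-trans ab∸d≤ (≤-reflexive (cong (λ x → (a ∸ y) * b + (b ∸ x) * a) (sym (coordinates-swap Gd))))))
      (≤-reflexive (distribute u (a ∸ y) (b ∸ BA.Y d) a b))
    where
    u = 1 * (n ∸ d)
    x = AB.X d
    y = AB.Y d
    distribute : ∀ u p q a b → u * (p * b + q * a) ≡ u * p * b + u * q * a
    distribute = solve-∀
    ab∸d≤ : a * b ∸ d ≤ (a ∸ y) * b + (b ∸ x) * a
    ab∸d≤ = m≤n+o⇒m∸n≤o (a * b) d (+-cancelʳ-≤ (a * b) _ _ (≤-reflexive (begin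
      a * b + a * b
        ≡⟨ cong₂ (λ p q → p * b + a * q) (sym (m+[n∸m]≡n (<⇒≤ (AB.Y<a d))))
                      (sym (m+[n∸m]≡n (<⇒≤ (AB.gap⇒X<b (G⇒gap Gd))))) ⟩
      (y + (a ∸ y)) * b + a * (x + (b ∸ x))                ≡⟨ regroup x y (a ∸ y) (b ∸ x) a b ⟩
      (x * a + y * b) + ((a ∸ y) * b + (b ∸ x) * a)        ≡⟨ cong (_+ ((a ∸ y) * b + (b ∸ x) * a)) (A-spec d) ⟨
      (d + a * b) + ((a ∸ y) * b + (b ∸ x) * a)            ≡⟨ rotate d (a * b) ((a ∸ y) * b + (b ∸ x) * a) ⟩
      (d + ((a ∸ y) * b + (b ∸ x) * a)) + a * b            ∎)))
      where
      open ≡-Reasoning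
      regroup : ∀ x y p q a b → (y + p) * b + a * (x + q) ≡ (x * a + y * b) + (p * b + q * a)
      regroup = solve-∀
      rotate : ∀ d e f → (d + e) + f ≡ (d + f) + e
      rotate = solve-∀

  private
    -- A multiple of `a` close to `ab/2`: subtracting it turns gaps into gaps, `c` is at most
    -- `ab/2`, and every gap is below `c + c`.
    c : ℕ
    c = a * ⌊ b /2⌋

    2⌊b/2⌋≤ : ∀ b → ⌊ b /2⌋ + ⌊ b /2⌋ ≤ b
    2⌊b/2⌋≤ b = subst (⌊ b /2⌋ + ⌊ b /2⌋ ≤_) (⌊n/2⌋+⌈n/2⌉≡n b) (+-monoʳ-≤ ⌊ b /2⌋ (⌊n/2⌋≤⌈n/2⌉ b))

    ≤1+2⌊b/2⌋ : ∀ b → b ≤ 1 + (⌊ b /2⌋ + ⌊ b /2⌋)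
    ≤1+2⌊b/2⌋ zero          = z≤n
    ≤1+2⌊b/2⌋ (suc zero)    = s≤s z≤n
    ≤1+2⌊b/2⌋ (suc (suc b)) = s≤s (subst (suc b ≤_) (cong suc (sym (+-suc ⌊ b /2⌋ ⌊ b /2⌋))) (s≤s (≤1+2⌊b/2⌋ b)))

    c+c≤ab : c + c ≤ a * b
    c+c≤ab = ≤-trans (≤-reflexive (sym (*-distribˡ-+ a ⌊ b /2⌋ ⌊ b /2⌋))) (*-monoʳ-≤ a (2⌊b/2⌋≤ b))

    -- From `X + 1 ≤ b` and `Y < a` a gap satisfies `d < ab − a`. Rounding down in `⌊ b /2⌋` loses
    -- at most one `a` in total, so `ab − a ≤ c + c`.
    gap<c+c : ∀ {d} → G d → d < c + c
    gap<c+c {d} Gd = +-cancelʳ-< (a * b + a) _ _ (begin-strict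
      d + (a * b + a)                     ≡⟨ +-assoc d (a * b) a ⟨
      d + a * b + a                       ≡⟨ cong (_+ a) (A-spec d) ⟩
      AB.X d * a + AB.Y d * b + a           ≡⟨ shuffle (AB.X d) (AB.Y d * b) a ⟩
      suc (AB.X d) * a + AB.Y d * b         <⟨ +-mono-≤-< (*-monoˡ-≤ a (AB.gap⇒X<b (G⇒gap Gd))) (*-monoˡ-< b (AB.Y<a d)) ⟩
      b * a + a * b                       ≡⟨ cong (_+ a * b) (*-comm b a) ⟩
      a * b + a * b                       ≤⟨ +-monoˡ-≤ (a * b) (*-monoʳ-≤ a (≤1+2⌊b/2⌋ b)) ⟩
      a * (1 + (⌊ b /2⌋ + ⌊ b /2⌋)) + a * b ≡⟨ regroup a ⌊ b /2⌋ b ⟩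
      c + c + (a * b + a)                 ∎)
      where
      open ≤-Reasoning
      shuffle : ∀ x yb a → x * a + yb + a ≡ suc x * a + yb
      shuffle = solve-∀
      regroup : ∀ a h b → a * (1 + (h + h)) + a * b ≡ a * h + a * h + (a * b + a)
      regroup = solve-∀

    w-vanishes-beyond-n : ∀ d → n ≤ d → w d ≡ 0
    w-vanishes-beyond-n d n≤d = trans (cong (𝟙 (G? d) *_) (m≤n⇒m∸n≡0 n≤d)) (*-zeroʳ (𝟙 (G? d)))

    w-vanishes-beyond-c+c : ∀ d → c + c ≤ d → w d ≡ 0
    w-vanishes-beyond-c+c d 2c≤d = cong (_* (n ∸ d)) (𝟙-no (G? d) (λ Gd → <⇒≱ (gap<c+c Gd) 2c≤d))

    -- Subtracting a multiple of a from a gap leaves a gap, and the smaller gap has the larger weight.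
    w-shift : ∀ d → w (c + d) ≤ w d
    w-shift d = *-mono-≤ (𝟙-mono (G? (c + d)) (G? d) (λ G[c+d] → gap⇒G (G⇒gap G[c+d] ∘ shift))) (∸-monoʳ-≤ n (m≤n+m d c))
      where
      shift : ⟨ a , b ⟩ d → ⟨ a , b ⟩ (c + d)
      shift (x , y , refl) = ⌊ b /2⌋ + x , y , regroup a b ⌊ b /2⌋ x y
        where
        regroup : ∀ a b h x y → (h + x) * a + y * b ≡ a * h + (x * a + y * b)
        regroup = solve-∀

    small-gaps : ∑[ d < n ] w (toℕ d) ≤ 2 * ∑[ d < c ] w (toℕ d)
    small-gaps = begin
      ∑[ d < n ] w (toℕ d)                                    ≤⟨ sum-vanishing n (c + c) w w-vanishes-beyond-c+c ⟩
      ∑[ d < c + c ] w (toℕ d)                                ≡⟨ sum-+ c c w ⟩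
      ∑[ d < c ] w (toℕ d) + ∑[ d < c ] w (c + toℕ d)
        ≤⟨ +-monoʳ-≤ (∑[ d < c ] w (toℕ d)) (sum-mono-≤ {c} (λ d → w-shift (toℕ d))) ⟩
      ∑[ d < c ] w (toℕ d) + ∑[ d < c ] w (toℕ d)             ≡⟨ cong (∑[ d < c ] w (toℕ d) +_) (+-identityʳ _) ⟨
      2 * ∑[ d < c ] w (toℕ d)                                ∎
      where open ≤-Reasoning

    -- One factor 2 comes from folding the upper gaps onto the lower ones, the other from
    -- `ab ≤ 2(ab − d)` for `d ≤ c`.
    weighted-gaps : (∑[ d < n ] w (toℕ d)) * (a * b) ≤ 4 * ∑[ d < n ] (w (toℕ d) * (a * b ∸ toℕ d))
    weighted-gaps = begin
      (∑[ d < n ] w (toℕ d)) * (a * b)                        ≤⟨ *-monoˡ-≤ (a * b) small-gaps ⟩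
      2 * (∑[ d < c ] w (toℕ d)) * (a * b)                    ≡⟨ *-assoc 2 (∑[ d < c ] w (toℕ d)) (a * b) ⟩
      2 * ((∑[ d < c ] w (toℕ d)) * (a * b))                  ≡⟨ cong (2 *_) (*-distribʳ-sum {c} (a * b) (w ∘ toℕ)) ⟩
      2 * ∑[ d < c ] (w (toℕ d) * (a * b))                    ≤⟨ *-monoʳ-≤ 2 (sum-mono-≤ {c} small) ⟩
      2 * ∑[ d < c ] (2 * v (toℕ d))                          ≡⟨ cong (2 *_) (*-distribˡ-sum {c} 2 (v ∘ toℕ)) ⟨
      2 * (2 * ∑[ d < c ] v (toℕ d))                          ≡⟨ *-assoc 2 2 (∑[ d < c ] v (toℕ d)) ⟨
      4 * ∑[ d < c ] v (toℕ d)
        ≤⟨ *-monoʳ-≤ 4 (sum-vanishing c n v (λ d n≤d → cong (_* (a * b ∸ d)) (w-vanishes-beyond-n d n≤d))) ⟩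
      4 * ∑[ d < n ] v (toℕ d)                                ∎
      where
      open ≤-Reasoning
      v : ℕ → ℕ
      v d = w d * (a * b ∸ d)
      half : ∀ {d} → d ≤ c → a * b ≤ 2 * (a * b ∸ d)
      half {d} d≤c = ≤-trans (≤-reflexive (sym (m∸n+n≡m d≤ab))) (+-monoʳ-≤ (a * b ∸ d)
        (≤-trans (m+n≤o⇒m≤o∸n d (≤-trans (+-mono-≤ d≤c d≤c) c+c≤ab)) (m≤m+n (a * b ∸ d) 0)))
        where
        d≤ab : d ≤ a * b
        d≤ab = ≤-trans d≤c (≤-trans (m≤m+n c c) c+c≤ab)
      pull : ∀ x y → x * (2 * y) ≡ 2 * (x * y)
      pull = solve-∀
      small : ∀ (d : Fin c) → w (toℕ d) * (a * b) ≤ 2 * v (toℕ d)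
      small d = ≤-trans (*-monoʳ-≤ (w (toℕ d)) (half (<⇒≤ (Fin.toℕ<n d))))
        (≤-reflexive (pull (w (toℕ d)) (a * b ∸ toℕ d)))

  -- Each of the two orders alone controls only one of the coordinates. Their inversion counts
  -- together reach a quarter of the weight, so the larger count reaches an eighth.
  many-inversions : Σ[ π ∈ Permutation′ n ] (∀ d → ⟨ a , b ⟩ d → Sorted d (array π)) ×
    (∑[ d < n ] w (toℕ d) ≤ 24 * inversions (array π))
  many-inversions = larger (≤-total iA iB)
    where
    lexA = lexicographic-permutation a b a≥2 b≥2 a⊥b G? G⇒gap n
    lexB = lexicographic-permutation b a b≥2 a≥2 (Coprime.sym a⊥b) G?
      (λ Gd (x , y , eq) → G⇒gap Gd (y , x , trans (+-comm (y * a) (x * b)) eq)) n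
    πA = proj₁ lexA
    πB = proj₁ lexB
    sortedA = proj₁ (proj₂ lexA)
    sortedB = proj₁ (proj₂ lexB)
    iA = inversions (array πA)
    iB = inversions (array πB)

    total : ∑[ d < n ] (w (toℕ d) * (a * b ∸ toℕ d)) ≤ (iA + iB) * (a * b)
    total = begin
      ∑[ d < n ] (w (toℕ d) * (a * b ∸ toℕ d))                ≤⟨ sum-mono-≤ {n} (λ d → complement-weights (toℕ d)) ⟩
      ∑[ d < n ] (fA d * b + fB d * a)                        ≡⟨ ∑-distrib-+ {n} (λ d → fA d * b) (λ d → fB d * a) ⟩
      ∑[ d < n ] (fA d * b) + ∑[ d < n ] (fB d * a)           ≡⟨ cong₂ _+_ (*-distribʳ-sum {n} b fA) (*-distribʳ-sum {n} a fB) ⟨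
      sum fA * b + sum fB * a
        ≤⟨ +-mono-≤ (*-monoˡ-≤ b (proj₂ (proj₂ lexA))) (*-monoˡ-≤ a (proj₂ (proj₂ lexB))) ⟩
      a * iA * b + b * iB * a                                 ≡⟨ regroup a b iA iB ⟩
      (iA + iB) * (a * b)                                     ∎
      where
      open ≤-Reasoning
      fA fB : Fin n → ℕ
      fA d = w (toℕ d) * (a ∸ AB.Y (toℕ d))
      fB d = w (toℕ d) * (b ∸ BA.Y (toℕ d))
      regroup : ∀ a b i j → a * i * b + b * j * a ≡ (i + j) * (a * b)
      regroup = solve-∀

    instance
      ab≢0 : NonZero (a * b)
      ab≢0 = m*n≢0 a b

    bound : ∑[ d < n ] w (toℕ d) ≤ 4 * (iA + iB)
    bound = *-cancelʳ-≤ _ _ (a * b)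
      (≤-trans weighted-gaps (≤-trans (*-monoʳ-≤ 4 total) (≤-reflexive (sym (*-assoc 4 (iA + iB) (a * b))))))

    enlarge : ∀ {i j k} → i ≤ k → j ≤ k → 4 * (i + j) ≤ 24 * k
    enlarge {i} {j} {k} i≤k j≤k = ≤-trans (*-monoʳ-≤ 4 (+-mono-≤ i≤k j≤k))
      -- The argument yields the constant 8; the difference 16 relaxes it to 24.
      (≤-trans (≤-reflexive (eight k)) (*-monoˡ-≤ k (m≤m+n 8 16)))
      where
      eight : ∀ k → 4 * (k + k) ≡ 8 * k
      eight = solve-∀

    larger : iA ≤ iB ⊎ iB ≤ iA → _
    larger (inj₁ iA≤iB) = πB , (λ d (x , y , eq) → sortedB d (y , x , trans (+-comm (y * b) (x * a)) eq)) ,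
      ≤-trans bound (enlarge iA≤iB ≤-refl)
    larger (inj₂ iB≤iA) = πA , sortedA , ≤-trans bound (enlarge ≤-refl iB≤iA)

-- The effect of one exchange on the number of inversions.

∑∑-product : ∀ {m n} (f : Fin m → ℕ) (g : Fin n → ℕ) → ∑[ i < m ] ∑[ j < n ] (f i * g j) ≡ sum f * sum g
∑∑-product {m} {n} f g = trans (sum-cong-≗ {m} (λ i → sym (*-distribˡ-sum {n} (f i) g))) (sym (*-distribʳ-sum {m} (sum g) f))

between? : ∀ l u i → Dec (l ≤ i × i < u)
between? l u i = (l ≤? i) ×-dec (i <? u)

count-between : ∀ n l u → ∑[ i < n ] 𝟙 (between? l u (toℕ i)) ≤ u ∸ l
count-between zero    l       u       = z≤n
count-between (suc n) l       zero    = ≤-trans (≤-reflexive (sum-0 {suc n} (λ i → 𝟙-no (between? l 0 (toℕ i)) λ ()))) z≤n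
count-between (suc n) zero    (suc u) = s≤s (≤-trans
  (sum-mono-≤ {n} (λ i → 𝟙-mono (between? 0 (suc u) (suc (toℕ i))) (between? 0 u (toℕ i)) λ (_ , i<u) → z≤n , s≤s⁻¹ i<u))
  (count-between n 0 u))
count-between (suc n) (suc l) (suc u) = ≤-trans
  (sum-mono-≤ {n} (λ i → 𝟙-mono (between? (suc l) (suc u) (suc (toℕ i))) (between? l u (toℕ i)) λ (l≤i , i<u) → s≤s⁻¹ l≤i , s≤s⁻¹ i<u))
  (count-between n l u)

module _ {n} (i j : Fin n) where

  private
    τ : Fin n → Fin n
    τ k = Perm.transpose i j ⟨$⟩ʳ k

  transpose-i : τ i ≡ j
  transpose-i with i Fin.≟ i
  ... | yes _  = refl
  ... | no i≢i = contradiction refl i≢i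

  transpose-j : τ j ≡ i
  transpose-j with j Fin.≟ i
  ... | yes j≡i = j≡i
  ... | no _ with j Fin.≟ j
  ...   | yes _  = refl
  ...   | no j≢j = contradiction refl j≢j

  transpose-≢ : ∀ {k} → k ≢ i → k ≢ j → τ k ≡ k
  transpose-≢ {k} k≢i k≢j with k Fin.≟ i
  ... | yes k≡i = contradiction k≡i k≢i
  ... | no _ with k Fin.≟ j
  ...   | yes k≡j = contradiction k≡j k≢j
  ...   | no _    = refl

  data TransposeView (k : Fin n) : Set where
    isˡ   : k ≡ i → τ k ≡ j → TransposeView k
    isʳ   : k ≡ j → τ k ≡ i → TransposeView k
    other : k ≢ i → k ≢ j → τ k ≡ k → TransposeView k

  transposeView : ∀ k → TransposeView k
  transposeView k = view (k Fin.≟ i) (k Fin.≟ j)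
    where
    view : Dec (k ≡ i) → Dec (k ≡ j) → TransposeView k
    view (yes refl) _          = isˡ refl transpose-i
    view (no _)     (yes refl) = isʳ refl transpose-j
    view (no k≢i)   (no k≢j)   = other k≢i k≢j (transpose-≢ k≢i k≢j)

  -- An exchange thus becomes a reindexing, so inversion counts before and after can be compared by
  -- permuting a double sum.
  lookup-exchange : ∀ x k → lookup (exchange i j x) k ≡ lookup x (τ k)
  lookup-exchange x k = by-cases (k Fin.≟ j) (k Fin.≟ i)
    where
    by-cases : Dec (k ≡ j) → Dec (k ≡ i) → lookup (exchange i j x) k ≡ lookup x (τ k)
    by-cases (yes refl) _          = trans (Vec.lookup∘update j (x Vec.[ i ]≔ lookup x j) (lookup x i))
      (cong (lookup x) (sym transpose-j))
    by-cases (no k≢j)   (yes refl) = trans (Vec.lookup∘update′ k≢j (x Vec.[ i ]≔ lookup x j) (lookup x i))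
      (trans (Vec.lookup∘update i x (lookup x j)) (cong (lookup x) (sym transpose-i)))
    by-cases (no k≢j)   (no k≢i)   = trans (Vec.lookup∘update′ k≢j (x Vec.[ i ]≔ lookup x j) (lookup x i))
      (trans (Vec.lookup∘update′ k≢i x (lookup x j)) (cong (lookup x) (sym (transpose-≢ k≢i k≢j))))

-- Only pairs (q , p) whose order the transposition reverses can cease to be inversions:
-- these have u as their later or l as their earlier member.
module _ {n} (u l : Fin n) (l≤u : l Fin.≤ u) where

  private
    τ : Fin n → Fin n
    τ k = Perm.transpose u l ⟨$⟩ʳ k

    Crossed? : ∀ p q → Dec (q Fin.< p × τ p Fin.< τ q)
    Crossed? p q = (q Fin.<? p) ×-dec (τ p Fin.<? τ q)

    I : ℕ → ℕ → Fin n → ℕ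
    I lo hi k = 𝟙 (between? lo hi (toℕ k))

    I-yes : ∀ lo hi k → lo ≤ toℕ k → toℕ k < hi → I lo hi k ≡ 1
    I-yes lo hi k lo≤k k<hi = 𝟙-yes (between? lo hi (toℕ k)) (lo≤k , k<hi)

    ends : ∀ p q → q Fin.< p → τ p Fin.< τ q → (p ≡ u × l Fin.≤ q × q Fin.< u) ⊎ (l Fin.< p × p Fin.< u × q ≡ l)
    ends p q q<p τp<τq with transposeView u l p | transposeView u l q
    ... | isˡ refl _     | isˡ refl _      = contradiction q<p (<-irrefl refl)
    ... | isˡ refl _     | isʳ refl _      = inj₁ (refl , ≤-refl , q<p)
    ... | isˡ refl τu≡l  | other _ _ τq≡q  = inj₁ (refl , <⇒≤ (subst₂ Fin._<_ τu≡l τq≡q τp<τq) , q<p)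
    ... | isʳ refl _     | isˡ refl _      = contradiction q<p (≤⇒≯ l≤u)
    ... | isʳ refl _     | isʳ refl _      = contradiction q<p (<-irrefl refl)
    ... | isʳ refl τl≡u  | other _ _ τq≡q  = contradiction (<-trans (<-≤-trans q<p l≤u) (subst₂ Fin._<_ τl≡u τq≡q τp<τq)) (<-irrefl refl)
    ... | other _ _ τp≡p | isˡ refl τu≡l   = contradiction (<-≤-trans (<-trans q<p (subst₂ Fin._<_ τp≡p τu≡l τp<τq)) l≤u) (<-irrefl refl)
    ... | other _ _ τp≡p | isʳ refl τl≡u   = inj₂ (q<p , subst₂ Fin._<_ τp≡p τl≡u τp<τq , refl)
    ... | other _ _ τp≡p | other _ _ τq≡q  = contradiction (<-trans q<p (subst₂ Fin._<_ τp≡p τq≡q τp<τq)) (<-irrefl refl)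

    -- The pair `(l , u)` is of both kinds but is charged only to the first product: the interval
    -- for `p` in the second starts at `l + 1`. This makes the total `2h − 1` instead of `2h` at a
    -- distance `h ≥ 1`.
    crossed≤ : ∀ p q → 𝟙 (Crossed? p q) ≤
      I (toℕ u) (suc (toℕ u)) p * I (toℕ l) (toℕ u) q + I (suc (toℕ l)) (toℕ u) p * I (toℕ l) (suc (toℕ l)) q
    crossed≤ p q = 𝟙-≤ (Crossed? p q) (λ (q<p , τp<τq) → by-end (ends p q q<p τp<τq))
      where
      by-end : (p ≡ u × l Fin.≤ q × q Fin.< u) ⊎ (l Fin.< p × p Fin.< u × q ≡ l) → _
      by-end (inj₁ (refl , l≤q , q<u)) = ≤-trans
        (≤-reflexive (sym (cong₂ _*_ (I-yes (toℕ u) (suc (toℕ u)) u ≤-refl ≤-refl) (I-yes (toℕ l) (toℕ u) q l≤q q<u))))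
        (m≤m+n _ _)
      by-end (inj₂ (l<p , p<u , refl)) = ≤-trans
        (≤-reflexive (sym (cong₂ _*_ (I-yes (suc (toℕ l)) (toℕ u) p l<p p<u) (I-yes (toℕ l) (suc (toℕ l)) l ≤-refl ≤-refl))))
        (m≤n+m _ _)

    crossed-total : ∑[ p < n ] ∑[ q < n ] 𝟙 (Crossed? p q) ≤ (toℕ u ∸ toℕ l) + (toℕ u ∸ suc (toℕ l))
    crossed-total = begin
      ∑[ p < n ] ∑[ q < n ] 𝟙 (Crossed? p q)                        ≤⟨ sum-mono-≤ {n} (λ p → sum-mono-≤ {n} (crossed≤ p)) ⟩
      ∑[ p < n ] ∑[ q < n ] (I₁ p * I₂ q + I₃ p * I₄ q)
        ≡⟨ sum-cong-≗ {n} (λ p → ∑-distrib-+ {n} (λ q → I₁ p * I₂ q) (λ q → I₃ p * I₄ q)) ⟩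
      ∑[ p < n ] (∑[ q < n ] (I₁ p * I₂ q) + ∑[ q < n ] (I₃ p * I₄ q))
        ≡⟨ ∑-distrib-+ {n} (λ p → ∑[ q < n ] (I₁ p * I₂ q)) (λ p → ∑[ q < n ] (I₃ p * I₄ q)) ⟩
      ∑[ p < n ] ∑[ q < n ] (I₁ p * I₂ q) + ∑[ p < n ] ∑[ q < n ] (I₃ p * I₄ q)
        ≡⟨ cong₂ _+_ (∑∑-product I₁ I₂) (∑∑-product I₃ I₄) ⟩
      sum I₁ * sum I₂ + sum I₃ * sum I₄
        ≤⟨ +-mono-≤ (*-mono-≤ (count-between n (toℕ u) (suc (toℕ u))) (count-between n (toℕ l) (toℕ u)))
                    (*-mono-≤ (count-between n (suc (toℕ l)) (toℕ u)) (count-between n (toℕ l) (suc (toℕ l)))) ⟩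
      (suc (toℕ u) ∸ toℕ u) * (toℕ u ∸ toℕ l) + (toℕ u ∸ suc (toℕ l)) * (suc (toℕ l) ∸ toℕ l)
        ≡⟨ cong₂ _+_ (trans (cong (_* (toℕ u ∸ toℕ l)) (m+n∸n≡m 1 (toℕ u))) (*-identityˡ _))
                     (trans (cong ((toℕ u ∸ suc (toℕ l)) *_) (m+n∸n≡m 1 (toℕ l))) (*-identityʳ _)) ⟩
      (toℕ u ∸ toℕ l) + (toℕ u ∸ suc (toℕ l)) ∎
      where
      open ≤-Reasoning
      I₁ I₂ I₃ I₄ : Fin n → ℕ
      I₁ = I (toℕ u) (suc (toℕ u))
      I₂ = I (toℕ l) (toℕ u)
      I₃ = I (suc (toℕ l)) (toℕ u)
      I₄ = I (toℕ l) (suc (toℕ l))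

  -- Both indices are permuted by the transposition. An inversion `(τ p , τ q)` of `x` either has
  -- `p < q`, and then `(p , q)` is an inversion after the exchange, or it is one of the crossed
  -- pairs.
  inversions-exchange : ∀ x → inversions x ≤ inversions (exchange u l x) + ((toℕ u ∸ toℕ l) + (toℕ u ∸ suc (toℕ l)))
  inversions-exchange x = begin
    inversions x                                                          ≡⟨ inversions-∑ x ⟩
    ∑[ p < n ] ∑[ q < n ] inv (p , q)                                     ≡⟨ sum-permute (λ p → ∑[ q < n ] inv (p , q)) ρ ⟩
    ∑[ p < n ] ∑[ q < n ] inv (τ p , q)
      ≡⟨ sum-cong-≗ {n} (λ p → sum-permute (λ q → inv (τ p , q)) ρ) ⟩
    ∑[ p < n ] ∑[ q < n ] inv (τ p , τ q)                                 ≤⟨ sum-mono-≤ {n} (λ p → sum-mono-≤ {n} (pointwise p)) ⟩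
    ∑[ p < n ] ∑[ q < n ] (inv′ (p , q) + 𝟙 (Crossed? p q))
      ≡⟨ sum-cong-≗ {n} (λ p → ∑-distrib-+ {n} (λ q → inv′ (p , q)) (λ q → 𝟙 (Crossed? p q))) ⟩
    ∑[ p < n ] (∑[ q < n ] inv′ (p , q) + ∑[ q < n ] 𝟙 (Crossed? p q))
      ≡⟨ ∑-distrib-+ {n} (λ p → ∑[ q < n ] inv′ (p , q)) (λ p → ∑[ q < n ] 𝟙 (Crossed? p q)) ⟩
    ∑[ p < n ] ∑[ q < n ] inv′ (p , q) + ∑[ p < n ] ∑[ q < n ] 𝟙 (Crossed? p q)
      ≤⟨ +-mono-≤ (≤-reflexive (sym (inversions-∑ (exchange u l x)))) crossed-total ⟩
    inversions (exchange u l x) + ((toℕ u ∸ toℕ l) + (toℕ u ∸ suc (toℕ l)))    ∎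
    where
    open ≤-Reasoning
    ρ = Perm.transpose u l
    inv inv′ : Fin n × Fin n → ℕ
    inv pq = 𝟙 (inversion? x pq)
    inv′ pq = 𝟙 (inversion? (exchange u l x) pq)
    pointwise : ∀ p q → inv (τ p , τ q) ≤ inv′ (p , q) + 𝟙 (Crossed? p q)
    pointwise p q = 𝟙-≤ (inversion? x (τ p , τ q)) by-order
      where
      by-order : Inversion x (τ p , τ q) → 1 ≤ inv′ (p , q) + 𝟙 (Crossed? p q)
      by-order (τp<τq , xτq<xτp) with <-cmp (toℕ p) (toℕ q)
      ... | tri< p<q _ _ = ≤-trans (≤-reflexive (sym (𝟙-yes (inversion? (exchange u l x) (p , q))
              (p<q , subst₂ Fin._<_ (sym (lookup-exchange u l x q)) (sym (lookup-exchange u l x p)) xτq<xτp)))) (m≤m+n _ _)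
      ... | tri≈ _ p≡q _ = contradiction τp<τq (<-irrefl (cong (toℕ ∘ τ) (Fin.toℕ-injective p≡q)))
      ... | tri> _ _ q<p = ≤-trans (≤-reflexive (sym (𝟙-yes (Crossed? p q) (q<p , τp<τq)))) (m≤n+m _ _)

-- Relations preserved by the passes, and the exchange potential.

foldl-lift : ∀ {A B : Set} (R : A → A → Set) → (∀ {σ} → R σ σ) → (∀ {σ τ υ} → R σ τ → R τ υ → R σ υ) →
  (f : A → B → A) (bs : List B) → All (λ b → ∀ σ → R σ (f σ b)) bs → ∀ σ → R σ (foldl f σ bs)
foldl-lift R R-refl R-trans f []       []       σ = R-refl
foldl-lift R R-refl R-trans f (b ∷ bs) (r ∷ rs) σ = R-trans (r σ) (foldl-lift R R-refl R-trans f bs rs (f σ b))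

insertKeyIfInRange-elim : ∀ {n} (Q : State n → Set) h r k {σ} →
  ((lt : r + k * h < n) → Q (insertKey h r k lt σ)) → (¬ r + k * h < n → Q σ) → Q (insertKeyIfInRange h r k σ)
insertKeyIfInRange-elim {n} Q h r k in-range out-of-range with r + k * h <? n
... | yes lt = in-range lt
... | no ≮n  = out-of-range ≮n

-- A pass is a nested fold of insertions, so a reflexive and transitive relation need only be
-- checked for one insertion. `Unchanged`, `Dissipates` and `Counted` are all lifted this way.
pass-lift : ∀ {n} (R : State n → State n → Set) → (∀ {σ} → R σ σ) → (∀ {σ τ υ} → R σ τ → R τ υ → R σ υ) →
  ∀ h → (∀ r k .(lt : r + k * h < n) σ → R σ (insertKey h r k lt σ)) → ∀ σ → R σ (pass h σ)
pass-lift {n} R R-refl R-trans h insert = foldl-lift R R-refl R-trans (λ τ r → sortChain h r τ) (upTo h)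
  (All.universal (λ r → foldl-lift R R-refl R-trans (λ τ k → insertKeyIfInRange h r k τ) (upTo n)
    (All.universal (inRange r) (upTo n))) (upTo h))
  where
  inRange : ∀ r k σ → R σ (insertKeyIfInRange h r k σ)
  inRange r k σ = insertKeyIfInRange-elim (R σ) h r k (λ lt → insert r k lt σ) (λ _ → R-refl)

later-position : ∀ {n} h r k .(lt : r + suc k * h < n) → toℕ (fromℕ< lt) ≡ toℕ (fromℕ< (h-before h r k lt)) + h
later-position h r k lt = trans (Fin.toℕ-fromℕ< lt)
  (trans (eq r h (k * h)) (cong (_+ h) (sym (Fin.toℕ-fromℕ< (h-before h r k lt)))))
  where
  eq : ∀ r h c → r + (h + c) ≡ r + c + h
  eq = solve-∀

if-elim : ∀ {A P : Set} (Q : A → Set) (P? : Dec P) {t f : A} → (P → Q t) → (¬ P → Q f) → Q (if does P? then t else f)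
if-elim Q (yes p) Qt Qf = Qt p
if-elim Q (no ¬p) Qt Qf = Qf ¬p

-- Sortedness is a premise inside the relation, which makes it transitive: unchanged keys hand the
-- premise on to the next step.
Unchanged : ∀ {n} → ℕ → State n → State n → Set
Unchanged h σ τ = Sorted h (keys σ) → keys τ ≡ keys σ × exchanges τ ≡ exchanges σ

insertKey-unchanged : ∀ {n} h r k .(lt : r + k * h < n) σ → Unchanged h σ (insertKey h r k lt σ)
insertKey-unchanged h r zero    lt σ             sorted = refl , refl
insertKey-unchanged h r (suc k) lt (state x e c) sorted = if-elim (λ τ → keys τ ≡ x × exchanges τ ≡ e)
  (lookup x u Fin.<? lookup x l)
  (λ xu<xl → contradiction xu<xl (≤⇒≯ (sorted l u (later-position h r k lt))))
  (λ _ → refl , refl)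
  where
  u = fromℕ< lt
  l = fromℕ< (h-before h r k lt)

pass-unchanged : ∀ {n} h (σ : State n) → Unchanged h σ (pass h σ)
pass-unchanged h = pass-lift (Unchanged h) (λ _ → refl , refl) (λ {σ} {τ} {υ} → R-trans {σ} {τ} {υ}) h (insertKey-unchanged h)
  where
  R-trans : ∀ {σ τ υ} → Unchanged h σ τ → Unchanged h τ υ → Unchanged h σ υ
  R-trans στ τυ s with στ s
  ... | k≡ , e≡ with τυ (subst (Sorted h) (sym k≡) s)
  ...   | k≡′ , e≡′ = trans k≡′ k≡ , trans e≡′ e≡

passes-unchanged : ∀ {n} hs (σ : State n) → All (λ h → Sorted h (keys σ)) hs →
  keys (foldl (λ τ h → pass h τ) σ hs) ≡ keys σ × exchanges (foldl (λ τ h → pass h τ) σ hs) ≡ exchanges σ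
passes-unchanged []       σ []       = refl , refl
passes-unchanged (h ∷ hs) σ (s ∷ ss) with pass-unchanged h σ s
... | k≡ , e≡ with passes-unchanged hs (pass h σ) (All.map (λ {d} → subst (Sorted d) (sym k≡)) ss)
...   | k≡′ , e≡′ = trans k≡′ k≡ , trans e≡′ e≡

-- A potential that never decreases: an exchange may destroy up to `K` inversions, but adds `K`
-- through the exchange count.
Dissipates : ∀ {n} → ℕ → State n → State n → Set
Dissipates K σ τ = inversions (keys σ) + exchanges σ * K ≤ inversions (keys τ) + exchanges τ * K

insertKey-dissipates : ∀ {n} K h → h + pred h ≤ K → ∀ r k .(lt : r + k * h < n) σ → Dissipates K σ (insertKey h r k lt σ)
insertKey-dissipates K h ≤K r zero    lt σ             = ≤-refl
insertKey-dissipates K h ≤K r (suc k) lt (state x e c) = if-elim (Dissipates K (state x e c)) (lookup x u Fin.<? lookup x l)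
  (λ _ → ≤-trans one-exchange (insertKey-dissipates K h ≤K r k (h-before h r k lt) (state (exchange u l x) (suc e) (suc c))))
  (λ _ → ≤-refl)
  where
  u = fromℕ< lt
  l = fromℕ< (h-before h r k lt)
  u≡l+h : toℕ u ≡ toℕ l + h
  u≡l+h = later-position h r k lt
  u∸l : toℕ u ∸ toℕ l ≡ h
  u∸l = trans (cong (_∸ toℕ l) u≡l+h) (m+n∸m≡n (toℕ l) h)
  u∸1+l : toℕ u ∸ suc (toℕ l) ≡ pred h
  u∸1+l = trans (sym (pred[m∸n]≡m∸[1+n] (toℕ u) (toℕ l))) (cong pred u∸l)
  one-exchange : inversions x + e * K ≤ inversions (exchange u l x) + suc e * K
  one-exchange = begin
    inversions x + e * K   ≤⟨ +-monoˡ-≤ (e * K) (inversions-exchange u l (subst (toℕ l ≤_) (sym u≡l+h) (m≤m+n (toℕ l) h)) x) ⟩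
    inversions (exchange u l x) + ((toℕ u ∸ toℕ l) + (toℕ u ∸ suc (toℕ l))) + e * K
      ≡⟨ cong₂ (λ v w → inversions (exchange u l x) + (v + w) + e * K) u∸l u∸1+l ⟩
    inversions (exchange u l x) + (h + pred h) + e * K   ≤⟨ +-monoˡ-≤ (e * K) (+-monoʳ-≤ (inversions (exchange u l x)) ≤K) ⟩
    inversions (exchange u l x) + K + e * K              ≡⟨ +-assoc (inversions (exchange u l x)) K (e * K) ⟩
    inversions (exchange u l x) + suc e * K              ∎
    where open ≤-Reasoning

passes-dissipate : ∀ {n} K hs → All (λ h → h + pred h ≤ K) hs → ∀ (σ : State n) → Dissipates K σ (foldl (λ τ h → pass h τ) σ hs)
passes-dissipate K hs ≤K = foldl-lift (Dissipates K) ≤-refl ≤-trans _ hs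
  (All.map (λ {h} h≤K → pass-lift (Dissipates K) ≤-refl ≤-trans h (insertKey-dissipates K h h≤K)) ≤K)

-- Correctness of the last pass.

PrefixSorted : ∀ {n} → ℕ → State n → Set
PrefixSorted {n} m σ = ∀ (i j : Fin n) → i Fin.< j → toℕ j < m → lookup (keys σ) i Fin.≤ lookup (keys σ) j

-- Sorted on [0 , m), except that the key at position k may be too small for its place.
SortedExcept : ∀ {n} → ℕ → ℕ → State n → Set
SortedExcept {n} k m σ = ∀ (i j : Fin n) → i Fin.< j → toℕ j < m → toℕ j ≢ k → lookup (keys σ) i Fin.≤ lookup (keys σ) j

-- An exchange moves the exceptional position from `k + 1` to `k`. When the key stops, the one
-- before it is no larger and already dominates the earlier ones.
insertKey-sorts : ∀ {n} m k .(lt : 0 + k * 1 < n) σ → SortedExcept k m σ → PrefixSorted m (insertKey 1 0 k lt σ)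
-- An exception at position 0 excludes nothing, since `j` has a predecessor `i`.
insertKey-sorts m zero    lt σ sorted i j i<j j<m = sorted i j i<j j<m (m<n⇒n≢0 i<j)
insertKey-sorts m (suc k) lt (state x e c) sorted = if-elim (PrefixSorted m) (lookup x u Fin.<? lookup x l)
  (λ xu<xl → insertKey-sorts m k (h-before 1 0 k lt) (state (exchange u l x) (suc e) (suc c)) (exchanged xu<xl))
  (in-place ∘ ≮⇒≥)
  where
  u = fromℕ< lt
  l = fromℕ< (h-before 1 0 k lt)
  u≡1+k : toℕ u ≡ suc k
  u≡1+k = trans (Fin.toℕ-fromℕ< lt) (*-identityʳ (suc k))
  l≡k : toℕ l ≡ k
  l≡k = trans (Fin.toℕ-fromℕ< (h-before 1 0 k lt)) (*-identityʳ k)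
  u≡1+l : toℕ u ≡ suc (toℕ l)
  u≡1+l = trans u≡1+k (cong suc (sym l≡k))
  l<u : l Fin.< u
  l<u = ≤-reflexive (sym u≡1+l)
  sorted-≢u : ∀ i j → i Fin.< j → toℕ j < m → j ≢ u → lookup x i Fin.≤ lookup x j
  sorted-≢u i j i<j j<m j≢u = sorted i j i<j j<m (λ j≡1+k → j≢u (Fin.toℕ-injective (trans j≡1+k (sym u≡1+k))))
  l≢u : l ≢ u
  l≢u l≡u = <-irrefl (cong toℕ l≡u) l<u
  below-u : ∀ {i} → i Fin.< u → i ≢ l → i Fin.< l
  below-u {i} i<u i≢l = ≤∧≢⇒< (s≤s⁻¹ (subst (toℕ i <_) u≡1+l i<u)) (i≢l ∘ Fin.toℕ-injective)
  above-l : ∀ {j} → l Fin.< j → j ≢ u → u Fin.< j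
  above-l {j} l<j j≢u = ≤∧≢⇒< (subst (_≤ toℕ j) (sym u≡1+l) l<j) (λ u≡j → j≢u (Fin.toℕ-injective (sym u≡j)))

  in-place : lookup x l Fin.≤ lookup x u → PrefixSorted m (state x e (suc c))
  in-place xl≤xu i j i<j j<m with j Fin.≟ u
  ... | no j≢u = sorted-≢u i j i<j j<m j≢u
  ... | yes refl with i Fin.≟ l
  ...   | yes refl = xl≤xu
  ...   | no i≢l   = ≤-trans (sorted-≢u i l (below-u i<j i≢l) (<-trans l<u j<m) l≢u) xl≤xu

  exchanged : lookup x u Fin.< lookup x l → SortedExcept k m (state (exchange u l x) (suc e) (suc c))
  exchanged xu<xl i j i<j j<m j≢k = subst₂ Fin._≤_ (sym (lookup-exchange u l x i)) (sym (lookup-exchange u l x j))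
    (by-cases (transposeView u l i) (transposeView u l j))
    where
    τ : Fin _ → Fin _
    τ = Perm.transpose u l ⟨$⟩ʳ_
    at : ∀ {i′ j′} → τ i ≡ i′ → τ j ≡ j′ → lookup x i′ Fin.≤ lookup x j′ → lookup x (τ i) Fin.≤ lookup x (τ j)
    at refl refl = id
    by-cases : TransposeView u l i → TransposeView u l j → lookup x (τ i) Fin.≤ lookup x (τ j)
    by-cases _                (isʳ refl _)       = contradiction l≡k j≢k
    by-cases (isˡ refl _)     (isˡ refl _)       = contradiction i<j (<-irrefl refl)
    by-cases (isʳ refl τi)    (isˡ refl τj)      = at τi τj (<⇒≤ xu<xl)
    by-cases (other _ i≢l τi) (isˡ refl τj)      = at τi τj (sorted-≢u i l (below-u i<j i≢l) (<-trans l<u j<m) l≢u)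
    by-cases (isˡ refl τi)    (other j≢u _ τj)   = at τi τj (sorted-≢u l j (<-trans l<u i<j) j<m j≢u)
    by-cases (isʳ refl τi)    (other j≢u _ τj)   = at τi τj (sorted-≢u u j (above-l i<j j≢u) j<m j≢u)
    by-cases (other _ _ τi)   (other j≢u _ τj)   = at τi τj (sorted-≢u i j i<j j<m j≢u)

foldl-applyUpTo : ∀ {A : Set} (P : ℕ → A → Set) (step : A → ℕ → A) (f : ℕ → ℕ) →
  (∀ k σ → P k σ → P (suc k) (step σ (f k))) → ∀ n σ → P 0 σ → P n (foldl step σ (applyUpTo f n))
foldl-applyUpTo P step f next zero    σ P0 = P0
foldl-applyUpTo P step f next (suc n) σ P0 = foldl-applyUpTo (P ∘ suc) step (f ∘ suc) (next ∘ suc) n (step σ (f 0)) (next 0 σ P0)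

pass-1-sorts : ∀ {n} (σ : State n) → PrefixSorted n (pass 1 σ)
-- With gap 1 there is a single chain, of remainder 0, and its `k`-th position is `k * 1`.
pass-1-sorts {n} σ = foldl-applyUpTo PrefixSorted (λ τ k → insertKeyIfInRange 1 0 k τ) id next n σ (λ _ _ _ ())
  where
  next : ∀ k τ → PrefixSorted k τ → PrefixSorted (suc k) (insertKeyIfInRange 1 0 k τ)
  next k τ sorted = insertKeyIfInRange-elim (PrefixSorted (suc k)) 1 0 k
    (λ lt → insertKey-sorts (suc k) k lt τ (λ i j i<j j<1+k j≢k → sorted i j i<j (≤∧≢⇒< (s≤s⁻¹ j<1+k) j≢k)))
    -- Out of range means `n ≤ k`, and then the sorted prefix is already the whole array.
    (λ ≮n i j i<j _ → sorted i j i<j (<-≤-trans (Fin.toℕ<n j) (subst (n ≤_) (*-identityʳ k) (≮⇒≥ ≮n))))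

PrefixSorted⇒inversions≡0 : ∀ {n} (σ : State n) → PrefixSorted n σ → inversions (keys σ) ≡ 0
PrefixSorted⇒inversions≡0 {n} σ sorted = trans (inversions-∑ (keys σ)) (sum-0 {n} (λ i → sum-0 {n} (λ j →
  𝟙-no (inversion? (keys σ) (i , j)) (λ (i<j , xj<xi) → <⇒≱ xj<xi (sorted i j i<j (Fin.toℕ<n j))))))

last⇒snoc : ∀ {A : Set} (xs : List A) {y} → List.last xs ≡ just y → ∃ λ ys → xs ≡ ys ++ y ∷ []
last⇒snoc (x ∷ [])     refl = [] , refl
last⇒snoc (x ∷ y ∷ xs) eq with last⇒snoc (y ∷ xs) eq
... | ys , eq′ = x ∷ ys , cong (x ∷_) eq′

-- The final gap is 1, and that pass sorts whatever state the earlier passes leave.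
shellsort-sorts : ∀ H {n} (x : Array n) → inversions (keys (shellsort H x)) ≡ 0
shellsort-sorts H x with gaps H | GapSequence.last-gap H
... | hs | last≡1 with last⇒snoc hs last≡1
...   | hs′ , refl rewrite List.foldl-++ (λ τ h → pass h τ) (state x 0 0) hs′ (1 ∷ []) =
  PrefixSorted⇒inversions≡0 (pass 1 σ) (pass-1-sorts σ)
  where σ = foldl (λ τ h → pass h τ) (state x 0 0) hs′

-- Comparison counts, and the exchanges made after the first passes.

Counted : ∀ {n} → State n → State n → Set
Counted σ τ = exchanges σ ≤ comparisons σ → exchanges τ ≤ comparisons τ

insertKey-counted : ∀ {n} h r k .(lt : r + k * h < n) σ → Counted σ (insertKey h r k lt σ)
insertKey-counted h r zero    lt σ             = id
insertKey-counted h r (suc k) lt (state x e c) = if-elim (Counted (state x e c)) (lookup x u Fin.<? lookup x l)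
  (λ _ → insertKey-counted h r k (h-before h r k lt) (state (exchange u l x) (suc e) (suc c)) ∘ s≤s)
  (λ _ → m≤n⇒m≤1+n)
  where
  u = fromℕ< lt
  l = fromℕ< (h-before h r k lt)

exchanges≤comparisons : ∀ H {n} (x : Array n) → exchanges (shellsort H x) ≤ comparisons (shellsort H x)
exchanges≤comparisons H x = foldl-lift Counted id (λ f g → g ∘ f) (λ τ h → pass h τ) (gaps H)
  (All.universal (λ h → pass-lift Counted id (λ f g → g ∘ f) h (insertKey-counted h)) (gaps H)) (state x 0 0) ≤-refl

-- Unit coefficient vectors. Hence an array sorted for all of `S H s` is sorted for each of the
-- first `s` gaps, as `passes-unchanged` requires.
combination-member : ∀ hs → All (Combination hs) hs
combination-member []       = []
combination-member (h ∷ hs) =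
  (1 Vec.∷ Vec.replicate _ 0 , trans (cong (1 * h +_) (zeros hs)) (trans (+-identityʳ (1 * h)) (*-identityˡ h)))
  ∷ All.map (λ (xs , eq) → 0 Vec.∷ xs , eq) (combination-member hs)
  where
  zeros : ∀ hs → ℕ.sum (List.zipWith _*_ (toList (Vec.replicate (length hs) 0)) hs) ≡ 0
  zeros []       = refl
  zeros (_ ∷ hs) = zeros hs

drop-bounded : ∀ {hs} → AllPairs _>_ hs → ∀ s (s<p : s < length hs) → All (_≤ List.lookup hs (fromℕ< s<p)) (drop s hs)
drop-bounded (h> ∷ _)  zero    (s≤s _)   = ≤-refl ∷ All.map <⇒≤ h>
drop-bounded (_ ∷ hs>) (suc s) (s≤s s<p) = drop-bounded hs> s s<p

lookup-last : ∀ (hs : List ℕ) {y} → List.last hs ≡ just y →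
  ∀ s (s<p : s < length hs) → s ≡ length hs ∸ 1 → List.lookup hs (fromℕ< s<p) ≡ y
lookup-last (h ∷ [])      refl zero    (s≤s _)   _    = refl
lookup-last (_ ∷ g ∷ hs)  eq   (suc s) (s≤s s<p) s≡   = lookup-last (g ∷ hs) eq s s<p (suc-injective s≡)

gapAfter-last : ∀ H s (s<p : s < p H) → s ≡ p H ∸ 1 → gapAfter H s s<p ≡ 1
gapAfter-last H = lookup-last (gaps H) (GapSequence.last-gap H)

-- The potential equals `inversions x` after the first `s` passes, and at the end only its exchange
-- term is left.
inversions≤exchanges : ∀ H s (s<p : s < p H) {n} (x : Array n) → (∀ d → S H s d → Sorted d x) →
  inversions x ≤ exchanges (shellsort H x) * (2 * gapAfter H s s<p ∸ 1)
inversions≤exchanges H s s<p x sorted = begin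
  inversions x                                            ≡⟨ cong inversions (proj₁ unchanged) ⟨
  inversions (keys σ)                                     ≡⟨ +-identityʳ (inversions (keys σ)) ⟨
  inversions (keys σ) + 0                                 ≡⟨ cong (λ e → inversions (keys σ) + e * K) (proj₂ unchanged) ⟨
  inversions (keys σ) + exchanges σ * K
    ≤⟨ passes-dissipate K (drop s (gaps H)) (All.map bound (drop-bounded gaps-decreasing s s<p)) σ ⟩
  inversions (keys τ) + exchanges τ * K                   ≡⟨ cong (λ υ → inversions (keys υ) + exchanges υ * K) τ≡ ⟩
  inversions (keys (shellsort H x)) + exchanges (shellsort H x) * K
    ≡⟨ cong (_+ exchanges (shellsort H x) * K) (shellsort-sorts H x) ⟩
  exchanges (shellsort H x) * K                           ∎
  where
  open ≤-Reasoning
  gaps-decreasing : AllPairs _>_ (gaps H)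
  gaps-decreasing = Linked⇒AllPairs (λ x>y y>z → <-trans y>z x>y) (GapSequence.decreasing H)
  h = gapAfter H s s<p
  K = 2 * h ∸ 1
  σ = foldl (λ τ h → pass h τ) (state x 0 0) (take s (gaps H))
  τ = foldl (λ τ h → pass h τ) σ (drop s (gaps H))
  unchanged = passes-unchanged (take s (gaps H)) (state x 0 0) (All.map (λ {d} → sorted d) (combination-member (take s (gaps H))))
  τ≡ : τ ≡ shellsort H x
  τ≡ = trans (sym (List.foldl-++ (λ τ h → pass h τ) (state x 0 0) (take s (gaps H)) (drop s (gaps H))))
             (cong (foldl (λ τ h → pass h τ) (state x 0 0)) (List.take++drop≡id s (gaps H)))
  h+pred≡ : ∀ h → h + pred h ≡ 2 * h ∸ 1
  h+pred≡ zero    = refl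
  h+pred≡ (suc h) = trans (cong suc (sym (cong (h +_) (+-identityʳ h)))) (sym (+-suc h (h + 0)))
  bound : ∀ {g} → g ≤ h → g + pred g ≤ K
  bound {g} g≤h = subst (g + pred g ≤_) (h+pred≡ h) (+-mono-≤ g≤h (pred-mono-≤ g≤h))

-- The list of permutations is complete up to pointwise equality, and pointwise equal permutations
-- have the same array and so the same cost.
cost≤worstCase : ∀ {n} (cost : Array n → ℕ) (π : Permutation′ n) → cost (array π) ≤ worstCase n cost
cost≤worstCase {n} cost π = v≤max⁺ 0 (map (cost ∘ array) (permutations n))
  (inj₂ (Any.map⁺ (Any.map (λ {ρ} → same-cost {ρ}) (permutations-complete π))))
  where
  same-cost : ∀ {ρ} → π Perm.≈ ρ → cost (array π) ≤ cost (array ρ)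
  same-cost π≈ρ = ≤-reflexive (cong cost (Vec.tabulate-cong π≈ρ))

-- Rational form of the bounds.

open import Data.Integer.Base as ℤ using (+_)
import Data.Integer.Properties as ℤ
open import Data.Rational.Unnormalised.Base as ℚ using (_/_)

fraction-≤ : ∀ {u w} d .{{_ : NonZero d}} → u ≤ w * d → (+ w) / 1 ℚ.≥ (+ u) / d
fraction-≤ {u} {w} (suc d) u≤wd = ℚ.*≤* (subst₂ ℤ._≤_ (ℤ.pos-* u 1) (ℤ.pos-* w (suc d))
  (ℤ.+≤+ (≤-trans (≤-reflexive (*-identityʳ u)) u≤wd)))

U-∑ : ∀ H s n → U H s n ≡ ∑[ d < n ] (𝟙 ((1 ≤? toℕ d) ×-dec ¬? (S? H s (toℕ d))) * (n ∸ toℕ d))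
U-∑ H s n = sum-map-filter (λ d → (1 ≤? d) ×-dec ¬? (S? H s d)) (n ∸_) id n

theorem4p3 : (H : GapSequence) (s : ℕ) → 1 ≤ s → (s<p : s < p H) →
    (a b : ℕ) → a ≥ 2 → b ≥ 2 → Coprime a b → S H s ≐ ⟨ a , b ⟩ →
    (n : ℕ) → n ≥ (a ∸ 1) * (b ∸ 1) →
    let bound = _/_ (+ U H s n) (24 * (2 * gapAfter H s s<p ∸ 1)) {{denominator-nonZero H s s<p}}
    in
    (Σ[ π ∈ Permutation′ n ]
    (∀ d → S H s d → Sorted d (array π)) ×
    (+ inversions (array π)) / 1 ℚ.≥ (+ U H s n) / 24) ×
    ((+ W n H) / 1 ℚ.≥ bound) ×
    (s ≡ p H ∸ 1 → (+ W n H) / 1 ℚ.≥ (+ U H (p H ∸ 1) n) / 24) ×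
    ((+ C n H) / 1 ℚ.≥ bound) ×
    (s ≡ p H ∸ 1 → (+ C n H) / 1 ℚ.≥ (+ U H (p H ∸ 1) n) / 24)
theorem4p3 H s 1≤s s<p a b a≥2 b≥2 a⊥b (S⊆⟨⟩ , ⟨⟩⊆S) n n≥ =
  (π , sorted , fraction-≤ 24 (≤-trans U≤ (≤-reflexive (*-comm 24 (inversions (array π)))))) ,
  general U≤W , last-gap U≤W , general U≤C , last-gap U≤C
  where
  found = many-inversions a b a≥2 b≥2 a⊥b (λ d → (1 ≤? d) ×-dec ¬? (S? H s d))
    (λ (_ , d∉S) d∈ → d∉S (⟨⟩⊆S d∈))
    -- `U` also demands `1 ≤ d`; this excludes no gap, as 0 lies in `⟨ a , b ⟩`.
    (λ {d} d∉ → n≢0⇒n>0 (λ d≡0 → d∉ (0 , 0 , sym d≡0)) , λ d∈S → d∉ (S⊆⟨⟩ d∈S))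
    n
  π = proj₁ found
  K = 2 * gapAfter H s s<p ∸ 1

  sorted : ∀ d → S H s d → Sorted d (array π)
  sorted d d∈S = proj₁ (proj₂ found) d (S⊆⟨⟩ d∈S)

  U≤ : U H s n ≤ 24 * inversions (array π)
  U≤ = ≤-trans (≤-reflexive (U-∑ H s n)) (proj₂ (proj₂ found))

  U≤cost : ∀ {cost} → exchanges (shellsort H (array π)) ≤ cost → U H s n ≤ cost * (24 * K)
  U≤cost {cost} e≤ = ≤-trans U≤ (≤-trans (*-monoʳ-≤ 24 (≤-trans (inversions≤exchanges H s s<p (array π) sorted) (*-monoˡ-≤ K e≤)))
    (≤-reflexive (rearrange cost K)))
    where
    rearrange : ∀ c k → 24 * (c * k) ≡ c * (24 * k)
    rearrange = solve-∀

  U≤W : U H s n ≤ W n H * (24 * K)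
  U≤W = U≤cost (cost≤worstCase (exchanges ∘ shellsort H) π)

  U≤C : U H s n ≤ C n H * (24 * K)
  U≤C = U≤cost (≤-trans (exchanges≤comparisons H (array π)) (cost≤worstCase (comparisons ∘ shellsort H) π))

  general : ∀ {cost} → U H s n ≤ cost * (24 * K) → (+ cost) / 1 ℚ.≥ _/_ (+ U H s n) (24 * K) {{denominator-nonZero H s s<p}}
  general = fraction-≤ (24 * K) {{denominator-nonZero H s s<p}}

  last-gap : ∀ {cost} → U H s n ≤ cost * (24 * K) → s ≡ p H ∸ 1 → (+ cost) / 1 ℚ.≥ (+ U H (p H ∸ 1) n) / 24
  -- For `s = p − 1` the next gap is 1, so the factor `2 * h ∸ 1` is 1 and the denominator evaluates
  -- to 24.
  last-gap {cost} U≤ s≡ = fraction-≤ 24 (subst₂ (λ t h → U H t n ≤ cost * (24 * (2 * h ∸ 1))) s≡ (gapAfter-last H s s<p s≡) U≤)
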